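{- Let $n$ and $d$ be positive integers with $d \le n$. Then $$ A_2(n,d) \ \ge\ \frac{2^n}{V(n,d-1)}\cdot \frac{\log_2 V(n,d-1) \;-\; \log_2\sqrt{e(n,d-1)}}{10}, $$ where $V$ and $e$ are as defined in the context.
   Context: $A_2(n,d)$ denotes the maximum number of codewords in a binary code of length $n$ and minimum Hamming distance $d$. $V(n,r)=\sum_{i=0}^{r}\binom{n}{i}$ is the volume of a Hamming sphere of radius $r$ in $\{0,1\}^n$. For $x\in\mathbb{R}$, $\lceil x\rceil^+$ denotes the smallest nonnegative integer $m$ with $m\ge x$. For positive integers $n$ and $r$ with $r\le n$, $$ e(n,r)=\frac{1}{6}\sum_{w=1}^{r}\binom{n}{w}\left(\sum_{i=1}^{r}\ \sum_{j=\lceil (w+i-r)/2\rceil^+}^{\min\{w,i\}}\binom{w}{j}\binom{n-w}{i-j}\;-\;1\right). $$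
   Formalization: The formal statement assumes e(n,d−1) > 0, which holds for all 3 ≤ d ≤ n; for d = 2 one has e(n,1) = 0 and for d = 1 e(n,0) is undefined (an empty sum, 0), so the logarithm of the square root of e has no meaning there. -}

module Defs where

open import Data.Nat using (ℕ; zero; suc; _+_; _*_; _∸_; _^_; _≤_; _⊓_; ⌈_/2⌉)
open import Data.Nat.Combinatorics using (_C_)
open import Data.Bool using (Bool; true; false; if_then_else_)
open import Data.Bool.Properties using () renaming (_≟_ to _≟ᵇ_)
open import Data.Vec using (Vec; []; _∷_)
open import Data.List using (List; length)
open import Data.List.Relation.Unary.AllPairs using (AllPairs)
open import Data.Product using (Σ; _×_)
open import Data.Integer as ℤ using (ℤ)
open import Relation.Nullary.Decidable using (does)

sumCount : ℕ → ℕ → (ℕ → ℕ) → ℕ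
sumCount a zero    f = 0
sumCount a (suc m) f = f a + sumCount (suc a) m f

sumFromTo : ℕ → ℕ → (ℕ → ℕ) → ℕ
sumFromTo a b f = sumCount a (suc b ∸ a) f

hamming : ∀ {n} → Vec Bool n → Vec Bool n → ℕ
hamming []       []       = 0
hamming (x ∷ xs) (y ∷ ys) = (if does (x ≟ᵇ y) then 0 else 1) + hamming xs ys

IsCode : (n d : ℕ) → List (Vec Bool n) → Set
IsCode n d C = AllPairs (λ x y → d ≤ hamming x y) C

IsA₂ : (n d a : ℕ) → Set
IsA₂ n d a =
  (Σ (List (Vec Bool n)) λ C → IsCode n d C × length C ≡ℕ a)
  × (∀ (C : List (Vec Bool n)) → IsCode n d C → length C ≤ a)
  where
  open import Relation.Binary.PropositionalEquality using () renaming (_≡_ to _≡ℕ_)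

V : ℕ → ℕ → ℕ
V n r = sumFromTo 0 r (λ i → n C i)

-- the double sum Σ_{i=1}^{r} Σ_{j=⌈(w+i-r)/2⌉⁺}^{min(w,i)} C(w,j) C(n-w,i-j)
-- note ⌈(w+i-r)/2⌉⁺ = ⌈ (w+i) ∸ r /2⌉ (natural subtraction truncates at 0)
innerSum : ℕ → ℕ → ℕ → ℕ
innerSum n r w =
  sumFromTo 1 r (λ i →
    sumFromTo ⌈ (w + i) ∸ r /2⌉ (w ⊓ i) (λ j → (w C j) * ((n ∸ w) C (i ∸ j))))

sixE : ℕ → ℕ → ℤ
sixE n r = go 1 r
  where
  go : ℕ → ℕ → ℤ
  go w zero    = ℤ.+ 0
  go w (suc m) = (ℤ.+ (n C w)) ℤ.* (ℤ.+ (innerSum n r w) ℤ.- ℤ.+ 1) ℤ.+ go (suc w) m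

{-# OPTIONS --safe #-}
-- Let r = d ∸ 1, let w = V n r, and join two words when they are at distance at most r; codes are the
-- independent sets I.  Weight I by q ^ (number of words outside I) (the hard-core model at fugacity 1 / q) and
-- put Q = q + 1.  For a word v condition on I away from the ball around v.  Let m be the number of neighbours of v
-- that remain available.  Each is occupied with probability at least 1 / Q − deg / Q², so if m is large the
-- expected number of occupied neighbours of v is large, as the neighbourhood of v spans only s = sixE n r ordered
-- adjacent pairs and Q² ≥ 2 s.  If m is small, then the partition function of the available neighbours is at
-- most (Q / q) ^ m, so that v itself is occupied with large probability.  Either way
-- w · P(v ∈ I) + E |I ∩ N(v)| ≥ j / 2, where j is least with 6 w² ≤ s · 32 ^ j, and summing over v gives
-- 2 ^ n · j ≤ 4 a w.  For j ≤ 4 this already follows from maximality of an optimal code.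
module Submission where

open import Defs
open import Data.Nat
open import Data.Nat.Properties
open import Data.Nat.Combinatorics using (_C_; nCk+nC[k+1]≡[n+1]C[k+1]; k>n⇒nCk≡0)
open import Data.Nat.ListAction using (sum)
open import Data.Nat.Tactic.RingSolver using (solve-∀)
open import Data.Integer as ℤ using (ℤ)
import Data.Integer.Properties as ℤ
import Data.Integer.Tactic.RingSolver as ℤ-Solver
open import Algebra using (AbelianGroup)
open import Algebra.Properties.Group (AbelianGroup.group ℤ.+-0-abelianGroup) using (∙-cancelʳ)
open import Data.Bool using (Bool; true; false; not; _∧_)
open import Data.Empty using (⊥-elim)
open import Data.List using (List; []; _∷_; _++_; length; map; filterᵇ)
open import Data.List.Relation.Binary.Permutation.Propositional using (_↭_; refl; prep; swap; trans; ↭-sym)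
open import Data.List.Relation.Binary.Permutation.Propositional.Properties using (shift; ++⁺ˡ)
open import Data.List.Relation.Unary.All as All using (All; []; _∷_)
open import Data.List.Relation.Unary.AllPairs using ([]; _∷_)
open import Data.Product using (∃; _×_; _,_; proj₁; proj₂)
open import Data.Sum using (_⊎_; inj₁; inj₂)
open import Data.Unit using (⊤; tt)
open import Data.Vec using (Vec; []; _∷_)
open import Function using (_∘_)
open import Relation.Nullary using (¬_; yes; no)
open import Relation.Binary.PropositionalEquality as ≡ using (_≡_; refl; sym; cong; cong₂; subst; subst₂)

-- Hard-core model

⟦_⟧ : Bool → ℕ
⟦ true ⟧ = 1
⟦ false ⟧ = 0

⟦∧⟧ : ∀ a b → ⟦ a ∧ b ⟧ ≡ ⟦ a ⟧ * ⟦ b ⟧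
⟦∧⟧ true b = sym (*-identityˡ ⟦ b ⟧)
⟦∧⟧ false b = refl

⟦⟧≤1 : ∀ b → ⟦ b ⟧ ≤ 1
⟦⟧≤1 true = ≤-refl
⟦⟧≤1 false = z≤n

∑ : {A : Set} → List A → (A → ℕ) → ℕ
∑ xs f = sum (map f xs)

∑-cong : {A : Set} (xs : List A) {f g : A → ℕ} → (∀ x → f x ≡ g x) → ∑ xs f ≡ ∑ xs g
∑-cong [] e = refl
∑-cong (x ∷ xs) e = cong₂ _+_ (e x) (∑-cong xs e)

∑-mono : {A : Set} (xs : List A) {f g : A → ℕ} → (∀ x → f x ≤ g x) → ∑ xs f ≤ ∑ xs g
∑-mono [] e = z≤n
∑-mono (x ∷ xs) e = +-mono-≤ (e x) (∑-mono xs e)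

+-interchange : ∀ a b c d → (a + b) + (c + d) ≡ (a + c) + (b + d)
+-interchange = solve-∀

∑-+ : {A : Set} (xs : List A) (f g : A → ℕ) → ∑ xs (λ x → f x + g x) ≡ ∑ xs f + ∑ xs g
∑-+ [] f g = refl
∑-+ (x ∷ xs) f g =
  ≡.trans (cong (f x + g x +_) (∑-+ xs f g)) (+-interchange (f x) (g x) (∑ xs f) (∑ xs g))

∑-* : {A : Set} (c : ℕ) (xs : List A) (f : A → ℕ) → ∑ xs (λ x → c * f x) ≡ c * ∑ xs f
∑-* c [] f = sym (*-zeroʳ c)
∑-* c (x ∷ xs) f = ≡.trans (cong (c * f x +_) (∑-* c xs f)) (sym (*-distribˡ-+ c (f x) (∑ xs f)))

∑-0 : {A : Set} (xs : List A) → ∑ xs (λ _ → 0) ≡ 0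
∑-0 [] = refl
∑-0 (x ∷ xs) = ∑-0 xs

∑-const : {A : Set} (xs : List A) (c : ℕ) → ∑ xs (λ _ → c) ≡ length xs * c
∑-const [] c = refl
∑-const (x ∷ xs) c = cong (c +_) (∑-const xs c)

∑-swap : {A B : Set} (xs : List A) (ys : List B) (f : A → B → ℕ) →
  ∑ xs (λ x → ∑ ys (f x)) ≡ ∑ ys (λ y → ∑ xs (λ x → f x y))
∑-swap [] ys f = sym (∑-0 ys)
∑-swap (x ∷ xs) ys f =
  ≡.trans (cong (∑ ys (f x) +_) (∑-swap xs ys f)) (sym (∑-+ ys (f x) (λ y → ∑ xs (λ x → f x y))))

∑-↭ : {A : Set} {xs ys : List A} (f : A → ℕ) → xs ↭ ys → ∑ xs f ≡ ∑ ys f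
∑-↭ f refl = refl
∑-↭ f (prep x p) = cong (f x +_) (∑-↭ f p)
∑-↭ f (swap {xs} {ys} x y p) =
  ≡.trans (cong (λ z → f x + (f y + z)) (∑-↭ f p)) (exch (f x) (f y) (∑ ys f))
  where
  exch : ∀ a b c → a + (b + c) ≡ b + (a + c)
  exch = solve-∀
∑-↭ f (trans p p') = ≡.trans (∑-↭ f p) (∑-↭ f p')

module HardCore {A : Set} (clash : A → A → Bool) (clash-sym : ∀ x y → clash x y ≡ clash y x) (q : ℕ) where

  free : A → List A → Bool
  free x [] = true
  free x (y ∷ J) = not (clash x y) ∧ free x J

  -- E xs J F sums F over the independent sets J ∪ I with I ⊆ xs, with weight q ^ |xs ∖ I| and no normalisation.
  E : List A → List A → (List A → ℕ) → ℕ
  E [] J F = F J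
  E (x ∷ xs) J F = q * E xs J F + ⟦ free x J ⟧ * E xs (x ∷ J) F

  free-↭ : ∀ x {J J'} → J ↭ J' → free x J ≡ free x J'
  free-↭ x refl = refl
  free-↭ x (prep y p) = cong (not (clash x y) ∧_) (free-↭ x p)
  free-↭ x (swap {J} {J'} y z p) rewrite free-↭ x p
    with clash x y | clash x z
  ... | true  | true  = refl
  ... | true  | false = refl
  ... | false | true  = refl
  ... | false | false = refl
  free-↭ x (trans p p') = ≡.trans (free-↭ x p) (free-↭ x p')

  Symmetric : (List A → ℕ) → Set
  Symmetric F = ∀ {J J'} → J ↭ J' → F J ≡ F J'

  E-state-↭ : ∀ {F} → Symmetric F → ∀ xs {J J'} → J ↭ J' → E xs J F ≡ E xs J' F
  E-state-↭ sF [] p = sF p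
  E-state-↭ sF (x ∷ xs) p =
    cong₂ (λ a b → q * a + b) (E-state-↭ sF xs p)
      (cong₂ (λ a b → ⟦ a ⟧ * b) (free-↭ x p) (E-state-↭ sF xs (prep x p)))

  -- Exposing `x` and `y` in either order yields the same four branches, and the branch with both
  -- carries the same clash factor either way. This allows a word to be exposed after all the words
  -- far from it.
  E-↭ : ∀ {F} → Symmetric F → ∀ {xs ys} → xs ↭ ys → ∀ J → E xs J F ≡ E ys J F
  E-↭ sF refl J = refl
  E-↭ sF (prep x p) J =
    cong₂ (λ a b → q * a + ⟦ free x J ⟧ * b) (E-↭ sF p J) (E-↭ sF p (x ∷ J))
  E-↭ {F} sF (swap {xs} {ys} x y p) J
    rewrite E-↭ sF p J | E-↭ sF p (x ∷ J) | E-↭ sF p (y ∷ J) | E-↭ sF p (y ∷ x ∷ J)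
          | E-state-↭ sF ys (swap y x (refl {xs = J}))
          | ⟦∧⟧ (not (clash y x)) (free y J) | ⟦∧⟧ (not (clash x y)) (free x J)
          | clash-sym x y
    = rearrange q ⟦ free x J ⟧ ⟦ free y J ⟧ ⟦ not (clash y x) ⟧
        (E ys J F) (E ys (x ∷ J) F) (E ys (y ∷ J) F) (E ys (x ∷ y ∷ J) F)
    where
    rearrange : ∀ q fx fy n e ex ey exy →
      q * (q * e + fy * ey) + fx * (q * ex + (n * fy) * exy) ≡
      q * (q * e + fx * ex) + fy * (q * ey + (n * fx) * exy)
    rearrange = solve-∀
  E-↭ sF (trans p p') J = ≡.trans (E-↭ sF p J) (E-↭ sF p' J)

  E-++ : ∀ xs ys J F → E (xs ++ ys) J F ≡ E xs J (λ J' → E ys J' F)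
  E-++ [] ys J F = refl
  E-++ (x ∷ xs) ys J F =
    cong₂ (λ a b → q * a + ⟦ free x J ⟧ * b) (E-++ xs ys J F) (E-++ xs ys (x ∷ J) F)

  E-0 : ∀ xs J → E xs J (λ _ → 0) ≡ 0
  E-0 [] J = refl
  E-0 (x ∷ xs) J rewrite E-0 xs J | E-0 xs (x ∷ J) | *-zeroʳ q | *-zeroʳ ⟦ free x J ⟧ = refl

  E-+ : ∀ xs J F G → E xs J (λ I → F I + G I) ≡ E xs J F + E xs J G
  E-+ [] J F G = refl
  E-+ (x ∷ xs) J F G rewrite E-+ xs J F G | E-+ xs (x ∷ J) F G =
    rearrange q ⟦ free x J ⟧ (E xs J F) (E xs J G) (E xs (x ∷ J) F) (E xs (x ∷ J) G)
    where
    rearrange : ∀ q f a b c d → q * (a + b) + f * (c + d) ≡ q * a + f * c + (q * b + f * d)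
    rearrange = solve-∀

  E-∑ : {B : Set} (vs : List B) (F : B → List A → ℕ) → ∀ xs J →
    E xs J (λ I → ∑ vs (λ v → F v I)) ≡ ∑ vs (λ v → E xs J (F v))
  E-∑ [] F xs J = E-0 xs J
  E-∑ (v ∷ vs) F xs J =
    ≡.trans (E-+ xs J (F v) (λ I → ∑ vs (λ v → F v I))) (cong (E xs J (F v) +_) (E-∑ vs F xs J))

  -- `Inv` is a property of the chosen set that survives every admissible insertion, so the
  -- pointwise comparison is required only at sets that can occur. The factors `a` and `b` replace
  -- division.
  E-mono : ∀ (Inv : List A → Set) a b {F G : List A → ℕ} →
    (∀ J → Inv J → a * F J ≤ b * G J) → ∀ xs →
    All (λ x → ∀ J → Inv J → free x J ≡ true → Inv (x ∷ J)) xs →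
    ∀ J → Inv J → a * E xs J F ≤ b * E xs J G
  E-mono Inv a b le [] [] J i = le J i
  E-mono Inv a b {F} {G} le (x ∷ xs) (s ∷ ss) J i with free x J in eq
  ... | true = subst₂ _≤_ (dist a q (E xs J F) (E xs (x ∷ J) F)) (dist b q (E xs J G) (E xs (x ∷ J) G))
        (+-mono-≤ (*-monoʳ-≤ q (E-mono Inv a b le xs ss J i))
                  (*-monoʳ-≤ 1 (E-mono Inv a b le xs ss (x ∷ J) (s J i eq))))
    where
    dist : ∀ a q e e' → q * (a * e) + 1 * (a * e') ≡ a * (q * e + 1 * e')
    dist = solve-∀
  ... | false = subst₂ _≤_ (dist a q (E xs J F)) (dist b q (E xs J G))
        (*-monoʳ-≤ q (E-mono Inv a b le xs ss J i))
    where
    dist : ∀ a q e → q * (a * e) ≡ a * (q * e + 0)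
    dist = solve-∀

  -- The partition function, given that `J` is already chosen.
  ζ : List A → List A → ℕ
  ζ xs J = E xs J (λ _ → 1)

  ζ≥ : ∀ xs J → q ^ length xs ≤ ζ xs J
  ζ≥ [] J = ≤-refl
  ζ≥ (x ∷ xs) J = ≤-trans (*-monoʳ-≤ q (ζ≥ xs J)) (m≤m+n _ _)

  -- Choosing `x` blocks all of `xs`, so only the branch that adds nothing survives.
  E-blocked : ∀ x xs J F → All (λ y → clash y x ≡ true) xs → E xs (x ∷ J) F ≡ q ^ length xs * F (x ∷ J)
  E-blocked x [] J F [] = sym (+-identityʳ _)
  E-blocked x (y ∷ xs) J F (c ∷ cs) rewrite c | E-blocked x xs J F cs =
    ≡.trans (+-identityʳ _) (sym (*-assoc q (q ^ length xs) _))

  degree : A → List A → ℕ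
  degree x xs = ∑ xs (λ y → ⟦ clash y x ⟧)

  -- Ordered adjacent pairs: each edge inside the list counts twice.
  edges₂ : List A → ℕ
  edges₂ [] = 0
  edges₂ (x ∷ xs) = 2 * degree x xs + edges₂ xs

  available : List A → List A → ℕ
  available xs J = ∑ xs (λ x → ⟦ free x J ⟧)

  -- The unnormalised expected number of chosen members of `xs`; the members of `J` are not counted.
  occupied : List A → List A → ℕ
  occupied [] J = 0
  occupied (x ∷ xs) J = q * occupied xs J + ⟦ free x J ⟧ * (ζ xs (x ∷ J) + occupied xs (x ∷ J))

  const-symmetric : Symmetric (λ _ → 1)
  const-symmetric _ = refl

  ζ-swap : ∀ xs x y J → ζ xs (x ∷ y ∷ J) ≡ ζ xs (y ∷ x ∷ J)
  ζ-swap xs x y J = E-state-↭ const-symmetric xs (swap x y refl)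

  ζ-anti : ∀ xs x J → ζ xs (x ∷ J) ≤ ζ xs J
  ζ-anti [] x J = ≤-refl
  ζ-anti (y ∷ xs) x J with clash y x
  ... | true = +-mono-≤ (*-monoʳ-≤ q (ζ-anti xs x J)) z≤n
  ... | false rewrite ζ-swap xs y x J =
    +-mono-≤ (*-monoʳ-≤ q (ζ-anti xs x J)) (*-monoʳ-≤ ⟦ free y J ⟧ (ζ-anti xs x (y ∷ J)))

  Q : ℕ
  Q = suc q

  -- The sets lost by blocking the neighbours of x meet one of them, and each is occupied with probability ≤ 1 / Q.
  ζ-block : ∀ xs x J → Q * ζ xs J ≤ Q * ζ xs (x ∷ J) + degree x xs * ζ xs J
  ζ-block [] x J = m≤m+n _ _
  ζ-block (y ∷ xs) x J with clash y x | free y J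
  ... | true | true = conflict q (ζ xs J) (ζ xs (y ∷ J)) (ζ xs (x ∷ J)) (degree x xs)
          (ζ-block xs x J) (ζ-anti xs y J)
    where
    l : ∀ q z zy → suc q * (q * z + 1 * zy) ≡ q * (suc q * z) + (q * zy + zy)
    l = solve-∀
    r : ∀ q z zy zx d → suc q * (q * zx + 0) + suc d * (q * z + 1 * zy) ≡
      q * (suc q * zx + d * z) + (q * z + zy) + d * zy
    r = solve-∀
    conflict : ∀ q z zy zx d → suc q * z ≤ suc q * zx + d * z → zy ≤ z →
      suc q * (q * z + 1 * zy) ≤ suc q * (q * zx + 0) + suc d * (q * z + 1 * zy)
    conflict q z zy zx d ih le rewrite l q z zy | r q z zy zx d =
      ≤-trans (+-mono-≤ (*-monoʳ-≤ q ih) (+-monoˡ-≤ zy (*-monoʳ-≤ q le))) (m≤m+n _ _)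
  ... | true | false = unavailable q (ζ xs J) (ζ xs (x ∷ J)) (degree x xs) (ζ-block xs x J)
    where
    l : ∀ q z → suc q * (q * z + 0) ≡ q * (suc q * z)
    l = solve-∀
    r : ∀ q z zx d → suc q * (q * zx + 0) + suc d * (q * z + 0) ≡ q * (suc q * zx + d * z) + q * z
    r = solve-∀
    unavailable : ∀ q z zx d → suc q * z ≤ suc q * zx + d * z →
      suc q * (q * z + 0) ≤ suc q * (q * zx + 0) + suc d * (q * z + 0)
    unavailable q z zx d ih rewrite l q z | r q z zx d = ≤-trans (*-monoʳ-≤ q ih) (m≤m+n _ _)
  ... | false | false = unavailable q (ζ xs J) (ζ xs (x ∷ J)) (degree x xs) (ζ-block xs x J)
    where
    l : ∀ q z → suc q * (q * z + 0) ≡ q * (suc q * z)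
    l = solve-∀
    r : ∀ q z zx d → suc q * (q * zx + 0) + d * (q * z + 0) ≡ q * (suc q * zx + d * z)
    r = solve-∀
    unavailable : ∀ q z zx d → suc q * z ≤ suc q * zx + d * z →
      suc q * (q * z + 0) ≤ suc q * (q * zx + 0) + d * (q * z + 0)
    unavailable q z zx d ih rewrite l q z | r q z zx d = *-monoʳ-≤ q ih
  ... | false | true rewrite ζ-swap xs y x J =
      both q (ζ xs J) (ζ xs (y ∷ J)) (ζ xs (x ∷ J)) (ζ xs (x ∷ y ∷ J)) (degree x xs)
        (ζ-block xs x J) (ζ-block xs x (y ∷ J))
    where
    l : ∀ q z zy → suc q * (q * z + 1 * zy) ≡ q * (suc q * z) + suc q * zy
    l = solve-∀
    r : ∀ q z zy zx zxy d → suc q * (q * zx + 1 * zxy) + d * (q * z + 1 * zy) ≡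
      q * (suc q * zx + d * z) + (suc q * zxy + d * zy)
    r = solve-∀
    both : ∀ q z zy zx zxy d → suc q * z ≤ suc q * zx + d * z → suc q * zy ≤ suc q * zxy + d * zy →
      suc q * (q * z + 1 * zy) ≤ suc q * (q * zx + 1 * zxy) + d * (q * z + 1 * zy)
    both q z zy zx zxy d ih ih' rewrite l q z zy | r q z zy zx zxy d = +-mono-≤ (*-monoʳ-≤ q ih) ih'

  available-∷ : ∀ xs x J → available xs J ≤ available xs (x ∷ J) + degree x xs
  available-∷ [] x J = z≤n
  available-∷ (y ∷ xs) x J with clash y x
  ... | true = ≤-trans (+-mono-≤ (⟦⟧≤1 (free y J)) (available-∷ xs x J))
                 (≤-reflexive (sym (+-suc (available xs (x ∷ J)) (degree x xs))))
  ... | false = ≤-trans (+-monoʳ-≤ ⟦ free y J ⟧ (available-∷ xs x J))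
                 (≤-reflexive (sym (+-assoc ⟦ free y J ⟧ (available xs (x ∷ J)) (degree x xs))))

  occupied-lower : ∀ xs J → Q * (available xs J * ζ xs J) ≤ Q * Q * occupied xs J + edges₂ xs * ζ xs J
  occupied-lower [] J = ≤-trans (≤-reflexive (*-zeroʳ q)) z≤n
  occupied-lower (x ∷ xs) J with free x J
  ... | false = unavailable q (available xs J) (ζ xs J) (occupied xs J) (edges₂ xs) (degree x xs) (occupied-lower xs J)
    where
    l : ∀ q m z → suc q * (m * (q * z + 0)) ≡ q * (suc q * (m * z))
    l = solve-∀
    r : ∀ q z o s d → suc q * suc q * (q * o + 0) + (2 * d + s) * (q * z + 0) ≡
      q * (suc q * suc q * o + s * z) + 2 * d * (q * z)
    r = solve-∀
    unavailable : ∀ q m z o s d → suc q * (m * z) ≤ suc q * suc q * o + s * z →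
      suc q * (m * (q * z + 0)) ≤ suc q * suc q * (q * o + 0) + (2 * d + s) * (q * z + 0)
    unavailable q m z o s d ih rewrite l q m z | r q z o s d = ≤-trans (*-monoʳ-≤ q ih) (m≤m+n _ _)
  ... | true = step q (available xs J) (available xs (x ∷ J)) (ζ xs J) (ζ xs (x ∷ J))
                 (occupied xs J) (occupied xs (x ∷ J)) (edges₂ xs) (degree x xs)
                 (occupied-lower xs J) (occupied-lower xs (x ∷ J)) (ζ-block xs x J)
                 (available-∷ xs x J) (ζ-anti xs x J)
    where
    l : ∀ q m z0 z1 → suc q * (suc m * (q * z0 + 1 * z1)) ≡
      q * (suc q * (m * z0)) + suc q * (m * z1) + q * (suc q * z0) + suc q * z1
    l = solve-∀
    mid : ∀ q m1 z0 z1 o0 s d →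
      q * (suc q * suc q * o0 + s * z0) + suc q * ((m1 + d) * z1) + q * (suc q * z1 + d * z0) + suc q * z1 ≡
      suc q * (m1 * z1) + q * d * z1 + (q * (suc q * suc q * o0 + s * z0) + d * z1 + q * (suc q * z1 + d * z0) + suc q * z1)
    mid = solve-∀
    r : ∀ q z0 z1 o0 o1 s d →
      suc q * suc q * (q * o0 + 1 * (z1 + o1)) + (2 * d + s) * (q * z0 + 1 * z1) ≡
      (suc q * suc q * o1 + s * z1) + q * d * z0 + (q * (suc q * suc q * o0 + s * z0) + d * z1 + q * (suc q * z1 + d * z0) + suc q * z1) + d * z1
    r = solve-∀
    step : ∀ q m0 m1 z0 z1 o0 o1 s d →
      suc q * (m0 * z0) ≤ suc q * suc q * o0 + s * z0 →
      suc q * (m1 * z1) ≤ suc q * suc q * o1 + s * z1 →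
      suc q * z0 ≤ suc q * z1 + d * z0 → m0 ≤ m1 + d → z1 ≤ z0 →
      suc q * (suc m0 * (q * z0 + 1 * z1)) ≤
      suc q * suc q * (q * o0 + 1 * (z1 + o1)) + (2 * d + s) * (q * z0 + 1 * z1)
    step q m0 m1 z0 z1 o0 o1 s d ih0 ih1 blk av anti = begin
      suc q * (suc m0 * (q * z0 + 1 * z1)) ≡⟨ l q m0 z0 z1 ⟩
      q * (suc q * (m0 * z0)) + suc q * (m0 * z1) + q * (suc q * z0) + suc q * z1
        ≤⟨ +-monoˡ-≤ (suc q * z1) (+-mono-≤ (+-mono-≤ (*-monoʳ-≤ q ih0) (*-monoʳ-≤ (suc q) (*-monoˡ-≤ z1 av))) (*-monoʳ-≤ q blk)) ⟩
      q * (suc q * suc q * o0 + s * z0) + suc q * ((m1 + d) * z1) + q * (suc q * z1 + d * z0) + suc q * z1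
        ≡⟨ mid q m1 z0 z1 o0 s d ⟩
      suc q * (m1 * z1) + q * d * z1 + (q * (suc q * suc q * o0 + s * z0) + d * z1 + q * (suc q * z1 + d * z0) + suc q * z1)
        -- Replacing `z1` by `z0` in the charge `q * d * z1` makes all charges fit into
        -- `2 * d * (q * z0 + 1 * z1)`, with `d * z1` to spare.
        ≤⟨ +-monoˡ-≤ _ (+-mono-≤ ih1 (*-monoʳ-≤ (q * d) anti)) ⟩
      (suc q * suc q * o1 + s * z1) + q * d * z0 + (q * (suc q * suc q * o0 + s * z0) + d * z1 + q * (suc q * z1 + d * z0) + suc q * z1)
        ≤⟨ m≤m+n _ (d * z1) ⟩
      (suc q * suc q * o1 + s * z1) + q * d * z0 + (q * (suc q * suc q * o0 + s * z0) + d * z1 + q * (suc q * z1 + d * z0) + suc q * z1) + d * z1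
        ≡⟨ sym (r q z0 z1 o0 o1 s d) ⟩
      suc q * suc q * (q * o0 + 1 * (z1 + o1)) + (2 * d + s) * (q * z0 + 1 * z1) ∎
      where open ≤-Reasoning

  ζ-upper : ∀ xs J → ζ xs J * q ^ available xs J ≤ Q ^ available xs J * q ^ length xs
  ζ-upper [] J = ≤-refl
  ζ-upper (x ∷ xs) J with free x J
  ... | false = begin
      (q * ζ xs J + 0) * q ^ m ≡⟨ l q (ζ xs J) (q ^ m) ⟩
      q * (ζ xs J * q ^ m) ≤⟨ *-monoʳ-≤ q (ζ-upper xs J) ⟩
      q * (Q ^ m * q ^ length xs) ≡⟨ r q (Q ^ m) (q ^ length xs) ⟩
      Q ^ m * (q * q ^ length xs) ∎
    where
    open ≤-Reasoning
    m = available xs J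
    l : ∀ q z p → (q * z + 0) * p ≡ q * (z * p)
    l = solve-∀
    r : ∀ q a b → q * (a * b) ≡ a * (q * b)
    r = solve-∀
  ... | true = begin
      (q * ζ xs J + 1 * ζ xs (x ∷ J)) * (q * q ^ m)
        ≤⟨ *-monoˡ-≤ (q * q ^ m) (+-monoʳ-≤ (q * ζ xs J) (*-monoʳ-≤ 1 (ζ-anti xs x J))) ⟩
      (q * ζ xs J + 1 * ζ xs J) * (q * q ^ m) ≡⟨ l q (ζ xs J) (q ^ m) ⟩
      Q * q * (ζ xs J * q ^ m) ≤⟨ *-monoʳ-≤ (Q * q) (ζ-upper xs J) ⟩
      Q * q * (Q ^ m * q ^ length xs) ≡⟨ r q (Q ^ m) (q ^ length xs) ⟩
      Q * Q ^ m * (q * q ^ length xs) ∎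
    where
    open ≤-Reasoning
    m = available xs J
    l : ∀ q z p → (q * z + 1 * z) * (q * p) ≡ suc q * q * (z * p)
    l = solve-∀
    r : ∀ q a b → suc q * q * (a * b) ≡ suc q * a * (q * b)
    r = solve-∀

  -- Each chosen member of `xs` adds at least 1 to the sum, and `J` adds `∑ J g` in every branch.
  E-∑-lower : ∀ (g : A → ℕ) xs → All (λ x → 1 ≤ g x) xs → ∀ J →
    occupied xs J + ∑ J g * ζ xs J ≤ E xs J (λ I → ∑ I g)
  E-∑-lower g [] [] J = ≤-reflexive (*-identityʳ _)
  E-∑-lower g (x ∷ xs) (1≤g ∷ all) J with free x J
  ... | false = ≤-trans (≤-reflexive (l q (occupied xs J) (∑ J g) (ζ xs J)))
                  (≤-trans (*-monoʳ-≤ q (E-∑-lower g xs all J)) (m≤m+n _ _))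
    where
    l : ∀ q o s z → q * o + 0 + s * (q * z + 0) ≡ q * (o + s * z)
    l = solve-∀
  ... | true = begin
      q * o + 1 * (z' + o') + s * (q * z + 1 * z') ≡⟨ l q o s z z' o' ⟩
      q * (o + s * z) + 1 * (o' + (1 + s) * z')
        ≤⟨ +-mono-≤ (*-monoʳ-≤ q (E-∑-lower g xs all J))
             (*-monoʳ-≤ 1 (≤-trans (+-monoʳ-≤ o' (*-monoˡ-≤ z' (+-monoˡ-≤ s 1≤g))) (E-∑-lower g xs all (x ∷ J)))) ⟩
      q * E xs J (λ I → ∑ I g) + 1 * E xs (x ∷ J) (λ I → ∑ I g) ∎
    where
    open ≤-Reasoning
    o = occupied xs J
    o' = occupied xs (x ∷ J)
    z = ζ xs J
    z' = ζ xs (x ∷ J)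
    s = ∑ J g
    l : ∀ q o s z z' o' → q * o + 1 * (z' + o') + s * (q * z + 1 * z') ≡ q * (o + s * z) + 1 * (o' + (1 + s) * z')
    l = solve-∀

-- Inequalities for the local trade-off

-- Bernoulli's inequality (1 - 1 / Q) ^ k ≥ 1 - k / Q for Q = q + 1, with denominators cleared.
bernoulli : ∀ q k → suc q * suc q ^ k ≤ suc q * q ^ k + k * suc q ^ k
bernoulli q zero = m≤m+n _ _
bernoulli q (suc k) = begin
  suc q * (suc q * suc q ^ k) ≤⟨ *-monoʳ-≤ (suc q) (bernoulli q k) ⟩
  suc q * (suc q * q ^ k + k * suc q ^ k) ≡⟨ l q k (q ^ k) (suc q ^ k) ⟩
  suc q * q ^ k + (suc q * (q * q ^ k) + k * (suc q * suc q ^ k))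
    ≤⟨ +-monoˡ-≤ _ (*-monoʳ-≤ (suc q) (^-monoˡ-≤ k (n≤1+n q))) ⟩
  suc q * suc q ^ k + (suc q * (q * q ^ k) + k * (suc q * suc q ^ k)) ≡⟨ r q k (q ^ k) (suc q ^ k) ⟩
  suc q * (q * q ^ k) + suc k * (suc q * suc q ^ k) ∎
  where
  open ≤-Reasoning
  l : ∀ q k a b → suc q * (suc q * a + k * b) ≡ suc q * a + (suc q * (q * a) + k * (suc q * b))
  l = solve-∀
  r : ∀ q k a b → suc q * b + (suc q * (q * a) + k * (suc q * b)) ≡ suc q * (q * a) + suc k * (suc q * b)
  r = solve-∀

^-distribʳ-* : ∀ k m n → (m * n) ^ k ≡ m ^ k * n ^ k
^-distribʳ-* zero m n = refl
^-distribʳ-* (suc k) m n = ≡.trans (cong (m * n *_) (^-distribʳ-* k m n)) (exchange m n (m ^ k) (n ^ k))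
  where
  exchange : ∀ a b c d → a * b * (c * d) ≡ a * c * (b * d)
  exchange = solve-∀

-- Bernoulli at exponent Q / 2 gives (q / Q) ^ h ≥ 1 / 2; this is why Q is taken even.
half-power : ∀ q h → suc q ≡ 2 * h → suc q ^ h ≤ 2 * q ^ h
half-power q h eq = *-cancelˡ-≤ (suc q) (+-cancelʳ-≤ (suc q * b) _ _ (begin
  suc q * b + suc q * b ≡⟨ l (suc q) b ⟩
  2 * (suc q * b) ≤⟨ *-monoʳ-≤ 2 (bernoulli q h) ⟩
  2 * (suc q * a + h * b) ≡⟨ r (suc q) h a b ⟩
  suc q * (2 * a) + 2 * h * b ≡⟨ cong (λ z → suc q * (2 * a) + z * b) (sym eq) ⟩
  suc q * (2 * a) + suc q * b ∎))
  where
  open ≤-Reasoning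
  a = q ^ h
  b = suc q ^ h
  l : ∀ q b → q * b + q * b ≡ 2 * (q * b)
  l = solve-∀
  r : ∀ q h a b → 2 * (q * a + h * b) ≡ q * (2 * a) + 2 * h * b
  r = solve-∀

-- For m ≥ Q (j + 1) / 2 the mean occupation m / Q - s / Q² is at least (j + 1) / 2 - 1 / 2.
many-available : ∀ q h j m ζ o s → suc q ≡ 2 * h → h * suc j ≤ m → 2 * s ≤ suc q * suc q →
  suc q * (m * ζ) ≤ suc q * suc q * o + s * ζ → j * ζ ≤ 2 * o
many-available q h j m ζ o s eq hm 2s≤ le = *-cancelˡ-≤ (suc q * suc q) (+-cancelʳ-≤ (suc q * suc q * ζ) _ _ (begin
  suc q * suc q * (j * ζ) + suc q * suc q * ζ ≡⟨ a (suc q) j ζ ⟩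
  suc q * (suc q * suc j * ζ) ≡⟨ cong (λ z → suc q * (z * suc j * ζ)) eq ⟩
  suc q * (2 * h * suc j * ζ) ≡⟨ b (suc q) h (suc j) ζ ⟩
  2 * (suc q * (h * suc j * ζ)) ≤⟨ *-monoʳ-≤ 2 (*-monoʳ-≤ (suc q) (*-monoˡ-≤ ζ hm)) ⟩
  2 * (suc q * (m * ζ)) ≤⟨ *-monoʳ-≤ 2 le ⟩
  2 * (suc q * suc q * o + s * ζ) ≡⟨ c (suc q * suc q) o s ζ ⟩
  suc q * suc q * (2 * o) + 2 * s * ζ ≤⟨ +-monoʳ-≤ (suc q * suc q * (2 * o)) (*-monoˡ-≤ ζ 2s≤) ⟩
  suc q * suc q * (2 * o) + suc q * suc q * ζ ∎))
  where
  open ≤-Reasoning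
  a : ∀ q j z → q * q * (j * z) + q * q * z ≡ q * (q * suc j * z)
  a = solve-∀
  b : ∀ q h k z → q * (2 * h * k * z) ≡ 2 * (q * (h * k * z))
  b = solve-∀
  c : ∀ q o s z → 2 * (q * o + s * z) ≡ q * (2 * o) + 2 * s * z
  c = solve-∀

-- Since (Q / q) ^ h ≤ 2, the ratio (Q / q) ^ m is at most 2 ^ (j + 1). In the application `p` is
-- the weight of leaving the whole neighbourhood empty.
few-available : ∀ q h j m ζ p .{{_ : NonZero q}} → suc q ≡ 2 * h → m ≤ h * suc j →
  ζ * q ^ m ≤ suc q ^ m * p → ζ ≤ 2 ^ suc j * p
few-available q h j m ζ p eq mh le = *-cancelʳ-≤ ζ (2 ^ suc j * p) (q ^ (h * suc j)) {{m^n≢0 q (h * suc j)}} (begin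
  ζ * q ^ (h * suc j) ≡⟨ cong (λ z → ζ * q ^ z) (sym split) ⟩
  ζ * q ^ (m + k) ≡⟨ cong (ζ *_) (^-distribˡ-+-* q m k) ⟩
  ζ * (q ^ m * q ^ k) ≡⟨ sym (*-assoc ζ (q ^ m) (q ^ k)) ⟩
  -- Padding `m` up to `h * suc j` uses only q ≤ Q.
  ζ * q ^ m * q ^ k ≤⟨ *-mono-≤ le (^-monoˡ-≤ k (n≤1+n q)) ⟩
  suc q ^ m * p * suc q ^ k ≡⟨ a (suc q ^ m) p (suc q ^ k) ⟩
  suc q ^ m * suc q ^ k * p ≡⟨ cong (_* p) (sym (^-distribˡ-+-* (suc q) m k)) ⟩
  suc q ^ (m + k) * p ≡⟨ cong (λ z → suc q ^ z * p) split ⟩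
  suc q ^ (h * suc j) * p ≡⟨ cong (_* p) (sym (^-*-assoc (suc q) h (suc j))) ⟩
  (suc q ^ h) ^ suc j * p ≤⟨ *-monoˡ-≤ p (^-monoˡ-≤ (suc j) (half-power q h eq)) ⟩
  (2 * q ^ h) ^ suc j * p ≡⟨ cong (_* p) (^-distribʳ-* (suc j) 2 (q ^ h)) ⟩
  2 ^ suc j * (q ^ h) ^ suc j * p ≡⟨ cong (λ z → 2 ^ suc j * z * p) (^-*-assoc q h (suc j)) ⟩
  2 ^ suc j * q ^ (h * suc j) * p ≡⟨ a (2 ^ suc j) (q ^ (h * suc j)) p ⟩
  2 ^ suc j * p * q ^ (h * suc j) ∎)
  where
  open ≤-Reasoning
  k = h * suc j ∸ m
  split : m + k ≡ h * suc j
  split = m+[n∸m]≡n mh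
  a : ∀ x y z → x * y * z ≡ x * z * y
  a = solve-∀

-- `q * ζ` and `p` are the weights with the centre vacant and occupied. The occupied share is at
-- least 1 / (Q · 2 ^ (j + 1)), and the value `f` there is large enough to pay for everything.
few-sufficient : ∀ q j ζ p e f w → ζ ≤ 2 ^ suc j * p → j * suc q * 2 ^ j ≤ w → w ≤ f →
  j * (q * ζ + p) ≤ 2 * (q * e + p * f)
few-sufficient q j ζ p e f w ζ≤ w≥ w≤f = begin
  j * (q * ζ + p) ≤⟨ *-monoʳ-≤ j (+-mono-≤ (*-monoʳ-≤ q ζ≤) (≤-trans (≤-reflexive (sym (*-identityˡ p))) (*-monoˡ-≤ p (m^n>0 2 (suc j))))) ⟩
  j * (q * (2 ^ suc j * p) + 2 ^ suc j * p) ≡⟨ a q j (2 ^ j) p ⟩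
  2 * (p * (j * suc q * 2 ^ j)) ≤⟨ *-monoʳ-≤ 2 (*-monoʳ-≤ p (≤-trans w≥ w≤f)) ⟩
  2 * (p * f) ≤⟨ *-monoʳ-≤ 2 (m≤n+m (p * f) (q * e)) ⟩
  2 * (q * e + p * f) ∎
  where
  open ≤-Reasoning
  a : ∀ q j t p → j * (q * (2 * t * p) + 2 * t * p) ≡ 2 * (p * (j * suc q * t))
  a = solve-∀

-- With the centre vacant, the occupied neighbours pay j / 2; with the centre occupied, its value is
-- at least w ≥ j.
many-sufficient : ∀ q j ζ p e f w → j * ζ ≤ 2 * e → j * suc q * 2 ^ j ≤ w → w ≤ f →
  j * (q * ζ + p) ≤ 2 * (q * e + p * f)
many-sufficient q j ζ p e f w le w≥ w≤f = begin
  j * (q * ζ + p) ≡⟨ a q j ζ p ⟩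
  q * (j * ζ) + p * j ≤⟨ +-mono-≤ (*-monoʳ-≤ q le) (*-monoʳ-≤ p (≤-trans j≤ (≤-trans w≥ (≤-trans w≤f (m≤m+n f _))))) ⟩
  q * (2 * e) + p * (2 * f) ≡⟨ b q e p f ⟩
  2 * (q * e + p * f) ∎
  where
  open ≤-Reasoning
  a : ∀ q j z p → j * (q * z + p) ≡ q * (j * z) + p * j
  a = solve-∀
  b : ∀ q e p f → q * (2 * e) + p * (2 * f) ≡ 2 * (q * e + p * f)
  b = solve-∀
  j≤ : j ≤ j * suc q * 2 ^ j
  j≤ = ≤-trans (m≤m*n j (suc q)) (m≤m*n (j * suc q) (2 ^ j) {{m^n≢0 2 j}})

module _ {A : Set} (clash : A → A → Bool) (clash-sym : ∀ x y → clash x y ≡ clash y x)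
  (q : ℕ) .{{_ : NonZero q}} where

  open HardCore clash clash-sym q

  -- As `v` is free there are two branches: `v` vacant, with `xs` still to be filled, and `v`
  -- chosen, which blocks all of `xs`. Whether the available neighbours reach Q (j + 1) / 2 decides
  -- which estimate applies.
  neighbourhood-bound : ∀ (g : A → ℕ) h j w v xs J → Q ≡ 2 * h → 2 * edges₂ xs ≤ Q * Q →
    j * Q * 2 ^ j ≤ w → w ≤ g v → All (λ x → 1 ≤ g x) xs → All (λ x → clash x v ≡ true) xs →
    free v J ≡ true → j * ζ (v ∷ xs) J ≤ 2 * E (v ∷ xs) J (λ I → ∑ I g)
  neighbourhood-bound g h j w v xs J Q≡ s≤ w≥ w≤g 1≤g near fr
    rewrite fr | E-blocked v xs J (λ _ → 1) near | E-blocked v xs J (λ I → ∑ I g) near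
          | *-identityʳ (q ^ length xs) | +-identityʳ (q ^ length xs)
          | +-identityʳ (q ^ length xs * (g v + ∑ J g))
    with ≤-total (h * suc j) (available xs J)
  ... | inj₁ many = many-sufficient q j (ζ xs J) (q ^ length xs) (E xs J (λ I → ∑ I g)) (g v + ∑ J g) w
        (≤-trans (many-available q h j (available xs J) (ζ xs J) (occupied xs J) (edges₂ xs)
                   Q≡ many s≤ (occupied-lower xs J))
                 (*-monoʳ-≤ 2 (≤-trans (m≤m+n (occupied xs J) _) (E-∑-lower g xs 1≤g J))))
        w≥ (≤-trans w≤g (m≤m+n _ _))
  ... | inj₂ few = few-sufficient q j (ζ xs J) (q ^ length xs) (E xs J (λ I → ∑ I g)) (g v + ∑ J g) w
        (few-available q h j (available xs J) (ζ xs J) (q ^ length xs) Q≡ few (ζ-upper xs J))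
        w≥ (≤-trans w≤g (m≤m+n _ _))

-- Counting in the cube

sumCount-cong : ∀ a m {f g} → (∀ i → a ≤ i → i < a + m → f i ≡ g i) → sumCount a m f ≡ sumCount a m g
sumCount-cong a zero e = refl
sumCount-cong a (suc m) e =
  cong₂ _+_ (e a ≤-refl (m<m+n a z<s))
    (sumCount-cong (suc a) m λ i a<i i< → e i (<⇒≤ a<i) (subst (i <_) (sym (+-suc a m)) i<))

sumCount-shift : ∀ a m f → sumCount (suc a) m f ≡ sumCount a m (λ i → f (suc i))
sumCount-shift a zero f = refl
sumCount-shift a (suc m) f = cong (f (suc a) +_) (sumCount-shift (suc a) m f)

sumCount-offset : ∀ a m f → sumCount a m f ≡ sumCount 0 m (λ i → f (a + i))
sumCount-offset zero m f = refl
sumCount-offset (suc a) m f = ≡.trans (sumCount-shift a m f) (sumCount-offset a m (λ i → f (suc i)))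

sumCount-+ : ∀ a m f g → sumCount a m (λ i → f i + g i) ≡ sumCount a m f + sumCount a m g
sumCount-+ a zero f g = refl
sumCount-+ a (suc m) f g =
  ≡.trans (cong (f a + g a +_) (sumCount-+ (suc a) m f g)) (+-interchange (f a) (g a) _ _)

sumCount-* : ∀ c a m f → sumCount a m (λ i → c * f i) ≡ c * sumCount a m f
sumCount-* c a zero f = sym (*-zeroʳ c)
sumCount-* c a (suc m) f =
  ≡.trans (cong (c * f a +_) (sumCount-* c (suc a) m f)) (sym (*-distribˡ-+ c (f a) _))

sumCount-0 : ∀ a m {f} → (∀ i → a ≤ i → i < a + m → f i ≡ 0) → sumCount a m f ≡ 0
sumCount-0 a zero e = refl
sumCount-0 a (suc m) e =
  cong₂ _+_ (e a ≤-refl (m<m+n a z<s))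
    (sumCount-0 (suc a) m λ i a<i i< → e i (<⇒≤ a<i) (subst (i <_) (sym (+-suc a m)) i<))

sumCount-split : ∀ a m k f → sumCount a (m + k) f ≡ sumCount a m f + sumCount (a + m) k f
sumCount-split a zero k f = cong (λ z → sumCount z k f) (sym (+-identityʳ a))
sumCount-split a (suc m) k f =
  ≡.trans (cong (f a +_) (≡.trans (sumCount-split (suc a) m k f)
            (cong (λ z → sumCount (suc a) m f + sumCount z k f) (sym (+-suc a m)))))
    (sym (+-assoc (f a) _ _))

sumCount-swap : ∀ a m b k (f : ℕ → ℕ → ℕ) →
  sumCount a m (λ i → sumCount b k (f i)) ≡ sumCount b k (λ j → sumCount a m (λ i → f i j))
sumCount-swap a zero b k f = sym (sumCount-0 b k λ _ _ _ → refl)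
sumCount-swap a (suc m) b k f =
  ≡.trans (cong (sumCount b k (f a) +_) (sumCount-swap (suc a) m b k f))
    (sym (sumCount-+ b k (f a) (λ j → sumCount (suc a) m (λ i → f i j))))

[_⩽_] : ℕ → ℕ → ℕ
[ a ⩽ b ] = ⟦ a ≤ᵇ b ⟧

[⩽]-true : ∀ {a b} → a ≤ b → [ a ⩽ b ] ≡ 1
[⩽]-true {a} {b} p with a ≤ᵇ b | ≤⇒≤ᵇ p
... | true | _ = refl

[⩽]-false : ∀ {a b} → ¬ a ≤ b → [ a ⩽ b ] ≡ 0
[⩽]-false {a} {b} p with a ≤ᵇ b | ≤ᵇ⇒≤ a b
... | true | f = ⊥-elim (p (f _))
... | false | _ = refl

[⩽]-cong : ∀ {a b c d} → (a ≤ b → c ≤ d) → (c ≤ d → a ≤ b) → [ a ⩽ b ] ≡ [ c ⩽ d ]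
[⩽]-cong {a} {b} f g with a ≤? b
... | yes p = ≡.trans ([⩽]-true p) (sym ([⩽]-true (f p)))
... | no p = ≡.trans ([⩽]-false p) (sym ([⩽]-false λ c → p (g c)))

[_⩽_⩽_] : ℕ → ℕ → ℕ → ℕ
[ a ⩽ i ⩽ b ] = [ a ⩽ i ] * [ i ⩽ b ]

sumFromTo-indicator : ∀ a b f {m} → b < m → sumCount 0 m (λ i → [ a ⩽ i ⩽ b ] * f i) ≡ sumFromTo a b f
sumFromTo-indicator a b f {m} b<m with a ≤? suc b
... | no a≰ = ≡.trans (sumCount-0 0 m outside) (cong (λ z → sumCount a z f) (sym (m≤n⇒m∸n≡0 (≰⇒≥ a≰))))
  where
  outside : ∀ i → 0 ≤ i → i < m → [ a ⩽ i ⩽ b ] * f i ≡ 0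
  outside i _ _ with a ≤? i
  ... | no p rewrite [⩽]-false p = refl
  ... | yes p rewrite [⩽]-false {i} {b} (λ i≤b → a≰ (≤-trans p (m≤n⇒m≤1+n i≤b))) | *-zeroʳ [ a ⩽ i ] = refl
... | yes a≤ = begin
  sumCount 0 m F ≡⟨ cong (λ z → sumCount 0 z F) (sym (m+[n∸m]≡n b<m)) ⟩
  sumCount 0 (suc b + k) F ≡⟨ sumCount-split 0 (suc b) k F ⟩
  sumCount 0 (suc b) F + sumCount (suc b) k F
    ≡⟨ cong₂ _+_ (cong (λ z → sumCount 0 z F) (sym (m+[n∸m]≡n a≤))) (sumCount-0 (suc b) k above) ⟩
  sumCount 0 (a + (suc b ∸ a)) F + 0 ≡⟨ +-identityʳ _ ⟩
  sumCount 0 (a + (suc b ∸ a)) F ≡⟨ sumCount-split 0 a (suc b ∸ a) F ⟩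
  sumCount 0 a F + sumCount a (suc b ∸ a) F ≡⟨ cong₂ _+_ (sumCount-0 0 a below) (sumCount-cong a (suc b ∸ a) within) ⟩
  sumFromTo a b f ∎
  where
  open ≡.≡-Reasoning
  F = λ i → [ a ⩽ i ⩽ b ] * f i
  k = m ∸ suc b
  below : ∀ i → 0 ≤ i → i < a → F i ≡ 0
  below i _ i<a rewrite [⩽]-false (<⇒≱ i<a) = refl
  above : ∀ i → suc b ≤ i → i < suc b + k → F i ≡ 0
  above i b<i _ rewrite [⩽]-false (<⇒≱ b<i) | *-zeroʳ [ a ⩽ i ] = refl
  within : ∀ i → a ≤ i → i < a + (suc b ∸ a) → F i ≡ f i
  within i a≤i i< rewrite [⩽]-true a≤i | [⩽]-true (≤-pred (subst (i <_) (m+[n∸m]≡n a≤) i<)) = *-identityˡ (f i)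

nC0≡1 : ∀ n → n C 0 ≡ 1
nC0≡1 n = refl

-- The binomial sum Σ C(m,i) φ(i), encoded by Pascal's recursion so that it follows the split of a
-- cube on one coordinate.
bin : ℕ → (ℕ → ℕ) → ℕ
bin zero φ = φ 0
bin (suc m) φ = bin m φ + bin m (λ i → φ (suc i))

bin-cong : ∀ m {φ ψ} → (∀ i → i ≤ m → φ i ≡ ψ i) → bin m φ ≡ bin m ψ
bin-cong zero e = e 0 z≤n
bin-cong (suc m) e = cong₂ _+_ (bin-cong m λ i p → e i (m≤n⇒m≤1+n p)) (bin-cong m λ i p → e (suc i) (s≤s p))

-- Coefficients beyond `m` vanish, so any larger cutoff `k` is allowed and sums of different lengths
-- can share one range.
bin-C : ∀ m φ {k} → m < k → bin m φ ≡ sumCount 0 k (λ i → (m C i) * φ i)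
bin-C zero φ {suc k} _ =
  ≡.trans (sym (+-identityʳ _))
    (cong₂ _+_ (sym (≡.trans (cong (_* φ 0) (nC0≡1 0)) (*-identityˡ (φ 0))))
      (sym (sumCount-0 1 k λ i 0<i _ → cong (_* φ i) (k>n⇒nCk≡0 0<i))))
bin-C (suc m) φ {suc k} (s≤s m<k) = begin
  bin m φ + bin m (λ i → φ (suc i)) ≡⟨ cong₂ _+_ (bin-C m φ (m≤n⇒m≤1+n m<k)) (bin-C m (λ i → φ (suc i)) m<k) ⟩
  (m C 0) * φ 0 + sumCount 1 k (λ i → (m C i) * φ i) + sumCount 0 k (λ i → (m C i) * φ (suc i))
    ≡⟨ cong (λ z → (m C 0) * φ 0 + z + sumCount 0 k (λ i → (m C i) * φ (suc i))) (sumCount-shift 0 k _) ⟩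
  (m C 0) * φ 0 + sumCount 0 k (λ i → (m C suc i) * φ (suc i)) + sumCount 0 k (λ i → (m C i) * φ (suc i))
    ≡⟨ +-assoc ((m C 0) * φ 0) (sumCount 0 k (λ i → (m C suc i) * φ (suc i))) _ ⟩
  (m C 0) * φ 0 + (sumCount 0 k (λ i → (m C suc i) * φ (suc i)) + sumCount 0 k (λ i → (m C i) * φ (suc i)))
    ≡⟨ cong₂ _+_ (cong (_* φ 0) (≡.trans (nC0≡1 m) (sym (nC0≡1 (suc m)))))
         (sym (sumCount-+ 0 k (λ i → (m C suc i) * φ (suc i)) (λ i → (m C i) * φ (suc i)))) ⟩
  (suc m C 0) * φ 0 + sumCount 0 k (λ i → (m C suc i) * φ (suc i) + (m C i) * φ (suc i))
    ≡⟨ cong ((suc m C 0) * φ 0 +_) (sumCount-cong 0 k λ i _ _ → pascal i) ⟩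
  (suc m C 0) * φ 0 + sumCount 0 k (λ i → (suc m C suc i) * φ (suc i))
    ≡⟨ cong ((suc m C 0) * φ 0 +_) (sym (sumCount-shift 0 k _)) ⟩
  sumCount 0 (suc k) (λ i → (suc m C i) * φ i) ∎
  where
  open ≡.≡-Reasoning
  pascal : ∀ i → (m C suc i) * φ (suc i) + (m C i) * φ (suc i) ≡ (suc m C suc i) * φ (suc i)
  pascal i = ≡.trans (sym (*-distribʳ-+ (φ (suc i)) (m C suc i) (m C i)))
    (cong (_* φ (suc i)) (≡.trans (+-comm (m C suc i) (m C i)) (nCk+nC[k+1]≡[n+1]C[k+1] m i)))

bin-range : ∀ n a b (f : ℕ → ℕ) → bin n (λ i → [ a ⩽ i ⩽ b ] * f i) ≡ sumFromTo a b (λ i → (n C i) * f i)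
bin-range n a b f = begin
  bin n (λ i → [ a ⩽ i ⩽ b ] * f i) ≡⟨ bin-C n _ (s≤s (m≤m+n n b)) ⟩
  sumCount 0 (suc (n + b)) (λ i → (n C i) * ([ a ⩽ i ⩽ b ] * f i))
    ≡⟨ sumCount-cong 0 (suc (n + b)) (λ i _ _ → exchange (n C i) [ a ⩽ i ⩽ b ] (f i)) ⟩
  sumCount 0 (suc (n + b)) (λ i → [ a ⩽ i ⩽ b ] * ((n C i) * f i))
    ≡⟨ sumFromTo-indicator a b (λ i → (n C i) * f i) (s≤s (m≤n+m b n)) ⟩
  sumFromTo a b (λ i → (n C i) * f i) ∎
  where
  open ≡.≡-Reasoning
  exchange : ∀ x y z → x * (y * z) ≡ y * (x * z)
  exchange = solve-∀

-- Sums over the cube by Hamming distance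

cube : ∀ n → List (Vec Bool n)
cube zero = [] ∷ []
cube (suc n) = map (true ∷_) (cube n) ++ map (false ∷_) (cube n)

∑-++ : {A : Set} (xs ys : List A) (f : A → ℕ) → ∑ (xs ++ ys) f ≡ ∑ xs f + ∑ ys f
∑-++ [] ys f = refl
∑-++ (x ∷ xs) ys f = ≡.trans (cong (f x +_) (∑-++ xs ys f)) (sym (+-assoc (f x) _ _))

∑-map : {A B : Set} (h : A → B) (xs : List A) (f : B → ℕ) → ∑ (map h xs) f ≡ ∑ xs (λ x → f (h x))
∑-map h [] f = refl
∑-map h (x ∷ xs) f = cong (f (h x) +_) (∑-map h xs f)

∑-cube-suc : ∀ n (f : Vec Bool (suc n) → ℕ) →
  ∑ (cube (suc n)) f ≡ ∑ (cube n) (λ u → f (true ∷ u)) + ∑ (cube n) (λ u → f (false ∷ u))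
∑-cube-suc n f = ≡.trans (∑-++ (map (true ∷_) (cube n)) _ f)
  (cong₂ _+_ (∑-map (true ∷_) (cube n) f) (∑-map (false ∷_) (cube n) f))

∑-cube-1 : ∀ n → ∑ (cube n) (λ _ → 1) ≡ 2 ^ n
∑-cube-1 zero = refl
∑-cube-1 (suc n) = ≡.trans (∑-cube-suc n (λ _ → 1))
  (≡.trans (cong₂ _+_ (∑-cube-1 n) (∑-cube-1 n)) (cong (2 ^ n +_) (sym (+-identityʳ (2 ^ n)))))

∑-hamming : ∀ {n} (v : Vec Bool n) φ → ∑ (cube n) (λ u → φ (hamming v u)) ≡ bin n φ
∑-hamming [] φ = +-identityʳ (φ 0)
∑-hamming {suc n} (true ∷ v) φ = ≡.trans (∑-cube-suc n _)
  (cong₂ _+_ (∑-hamming v φ) (∑-hamming v (λ i → φ (suc i))))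
∑-hamming {suc n} (false ∷ v) φ = ≡.trans (∑-cube-suc n _)
  (≡.trans (cong₂ _+_ (∑-hamming v (λ i → φ (suc i))) (∑-hamming v φ)) (+-comm _ (bin n φ)))

hamming-sym : ∀ {n} (u v : Vec Bool n) → hamming u v ≡ hamming v u
hamming-sym [] [] = refl
hamming-sym (true ∷ u) (true ∷ v) = hamming-sym u v
hamming-sym (true ∷ u) (false ∷ v) = cong suc (hamming-sym u v)
hamming-sym (false ∷ u) (true ∷ v) = cong suc (hamming-sym u v)
hamming-sym (false ∷ u) (false ∷ v) = hamming-sym u v

hamming-refl : ∀ {n} (u : Vec Bool n) → hamming u u ≡ 0
hamming-refl [] = refl
hamming-refl (true ∷ u) = hamming-refl u
hamming-refl (false ∷ u) = hamming-refl u

hamming-0 : ∀ {n} (u v : Vec Bool n) → hamming u v ≡ 0 → u ≡ v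
hamming-0 [] [] _ = refl
hamming-0 (true ∷ u) (true ∷ v) e = cong (true ∷_) (hamming-0 u v e)
hamming-0 (false ∷ u) (false ∷ v) e = cong (false ∷_) (hamming-0 u v e)

hamming≤n : ∀ {n} (u v : Vec Bool n) → hamming u v ≤ n
hamming≤n [] [] = z≤n
hamming≤n (true ∷ u) (true ∷ v) = m≤n⇒m≤1+n (hamming≤n u v)
hamming≤n (true ∷ u) (false ∷ v) = s≤s (hamming≤n u v)
hamming≤n (false ∷ u) (true ∷ v) = s≤s (hamming≤n u v)
hamming≤n (false ∷ u) (false ∷ v) = m≤n⇒m≤1+n (hamming≤n u v)

∑-ball : ∀ {n} (v : Vec Bool n) r → ∑ (cube n) (λ u → [ hamming v u ⩽ r ]) ≡ V n r
∑-ball {n} v r = begin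
  ∑ (cube n) (λ u → [ hamming v u ⩽ r ]) ≡⟨ ∑-hamming v (λ i → [ i ⩽ r ]) ⟩
  bin n (λ i → [ i ⩽ r ]) ≡⟨ bin-cong n (λ i _ → sym (≡.trans (*-identityʳ _) (+-identityʳ _))) ⟩
  bin n (λ i → [ 0 ⩽ i ⩽ r ] * 1) ≡⟨ bin-range n 0 r (λ _ → 1) ⟩
  sumFromTo 0 r (λ i → (n C i) * 1) ≡⟨ sumCount-cong 0 (suc r) (λ i _ _ → *-identityʳ (n C i)) ⟩
  V n r ∎
  where open ≡.≡-Reasoning

-- pairs w b φ sums φ (hamming v z) (hamming u z) over z, where v and u differ in w positions and agree in b.
pairs : ℕ → ℕ → (ℕ → ℕ → ℕ) → ℕ
pairs zero b φ = bin b (λ l → φ l l)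
pairs (suc w) b φ = pairs w b (λ i k → φ i (suc k)) + pairs w b (λ i k → φ (suc i) k)

-- `pairs` uses up the differing positions first, whereas an agreeing coordinate may come anywhere
-- in a word; this peels one off at any stage.
pairs-suc : ∀ w b φ → pairs w (suc b) φ ≡ pairs w b φ + pairs w b (λ i k → φ (suc i) (suc k))
pairs-suc zero b φ = refl
pairs-suc (suc w) b φ =
  ≡.trans (cong₂ _+_ (pairs-suc w b _) (pairs-suc w b _)) (+-interchange (pairs w b _) (pairs w b _) (pairs w b _) (pairs w b _))

∑-hamming₂ : ∀ {n} (v u : Vec Bool n) φ →
  ∑ (cube n) (λ z → φ (hamming v z) (hamming u z)) ≡ pairs (hamming v u) (n ∸ hamming v u) φ
∑-hamming₂ [] [] φ = +-identityʳ (φ 0 0)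
∑-hamming₂ {suc n} (true ∷ v) (true ∷ u) φ rewrite +-∸-assoc 1 (hamming≤n v u) =
  ≡.trans (∑-cube-suc n _) (≡.trans (cong₂ _+_ (∑-hamming₂ v u φ) (∑-hamming₂ v u (λ i k → φ (suc i) (suc k))))
    (sym (pairs-suc (hamming v u) (n ∸ hamming v u) φ)))
∑-hamming₂ {suc n} (false ∷ v) (false ∷ u) φ rewrite +-∸-assoc 1 (hamming≤n v u) =
  ≡.trans (∑-cube-suc n _) (≡.trans (cong₂ _+_ (∑-hamming₂ v u (λ i k → φ (suc i) (suc k))) (∑-hamming₂ v u φ))
    (≡.trans (+-comm _ (pairs (hamming v u) (n ∸ hamming v u) φ)) (sym (pairs-suc (hamming v u) (n ∸ hamming v u) φ))))
∑-hamming₂ {suc n} (true ∷ v) (false ∷ u) φ =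
  ≡.trans (∑-cube-suc n _) (cong₂ _+_ (∑-hamming₂ v u (λ i k → φ i (suc k))) (∑-hamming₂ v u (λ i k → φ (suc i) k)))
∑-hamming₂ {suc n} (false ∷ v) (true ∷ u) φ =
  ≡.trans (∑-cube-suc n _) (≡.trans (cong₂ _+_ (∑-hamming₂ v u (λ i k → φ (suc i) k)) (∑-hamming₂ v u (λ i k → φ i (suc k))))
    (+-comm (pairs (hamming v u) (n ∸ hamming v u) _) _))

-- `j` counts the differing positions where z departs from v, so z departs from u in the other
-- `w ∸ j`; `l` counts the agreeing positions where z departs from both.
pairs-bin : ∀ w b φ → pairs w b φ ≡ bin w (λ j → bin b (λ l → φ (j + l) ((w ∸ j) + l)))
pairs-bin zero b φ = refl
pairs-bin (suc w) b φ = cong₂ _+_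
  (≡.trans (pairs-bin w b _)
    (bin-cong w λ j j≤w → bin-cong b λ l _ → cong (λ z → φ (j + l) (z + l)) (sym (+-∸-assoc 1 j≤w))))
  (pairs-bin w b _)

-- The left condition says w + i ≤ r + 2j; halving and rounding up gives the lower limit in
-- `innerSum`.
half-bound : ∀ w i j r → j ≤ w → j ≤ i → [ (w ∸ j) + (i ∸ j) ⩽ r ] ≡ [ ⌈ (w + i) ∸ r /2⌉ ⩽ j ]
half-bound w i j r j≤w j≤i = [⩽]-cong to from
  where
  total : (w ∸ j) + (i ∸ j) + (j + j) ≡ w + i
  total = ≡.trans (+-interchange (w ∸ j) (i ∸ j) j j) (cong₂ _+_ (m∸n+n≡m j≤w) (m∸n+n≡m j≤i))
  to : (w ∸ j) + (i ∸ j) ≤ r → ⌈ (w + i) ∸ r /2⌉ ≤ j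
  to p = subst (⌈ (w + i) ∸ r /2⌉ ≤_) (sym (n≡⌈n+n/2⌉ j))
    (⌈n/2⌉-mono (m≤n+o⇒m∸n≤o (w + i) r (subst (_≤ r + (j + j)) total (+-monoˡ-≤ (j + j) p))))
  from : ⌈ (w + i) ∸ r /2⌉ ≤ j → (w ∸ j) + (i ∸ j) ≤ r
  from p = +-cancelʳ-≤ (j + j) _ _ (subst (_≤ r + (j + j)) (sym total)
    (≤-trans (m≤n+m∸n (w + i) r) (+-monoʳ-≤ r (begin
      (w + i) ∸ r ≡⟨ sym (⌊n/2⌋+⌈n/2⌉≡n ((w + i) ∸ r)) ⟩
      ⌊ (w + i) ∸ r /2⌋ + ⌈ (w + i) ∸ r /2⌉ ≤⟨ +-monoˡ-≤ _ (⌊n/2⌋≤⌈n/2⌉ ((w + i) ∸ r)) ⟩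
      ⌈ (w + i) ∸ r /2⌉ + ⌈ (w + i) ∸ r /2⌉ ≤⟨ +-mono-≤ p p ⟩
      j + j ∎))))
    where open ≤-Reasoning

-- Substitute i = j + l, the distance from v. The bound on the distance from u then becomes the
-- lower limit on j.
pairs-inner : ∀ n r w → w ≤ n → pairs w (n ∸ w) (λ i k → [ 1 ⩽ i ⩽ r ] * [ k ⩽ r ]) ≡ innerSum n r w
pairs-inner n r w w≤n = begin
  pairs w b φ ≡⟨ pairs-bin w b φ ⟩
  bin w (λ j → bin b (λ l → φ (j + l) ((w ∸ j) + l))) ≡⟨ bin-cong w reindex ⟩
  bin w (λ j → sumCount 0 m (λ i → [ j ⩽ i ] * ((b C (i ∸ j)) * φ i ((w ∸ j) + (i ∸ j)))))
    ≡⟨ bin-C w _ w<m ⟩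
  sumCount 0 m (λ j → (w C j) * sumCount 0 m (λ i → [ j ⩽ i ] * ((b C (i ∸ j)) * φ i ((w ∸ j) + (i ∸ j)))))
    ≡⟨ sumCount-cong 0 m (λ j _ _ → sym (sumCount-* (w C j) 0 m _)) ⟩
  sumCount 0 m (λ j → sumCount 0 m (λ i → (w C j) * ([ j ⩽ i ] * ((b C (i ∸ j)) * φ i ((w ∸ j) + (i ∸ j))))))
    ≡⟨ sumCount-swap 0 m 0 m _ ⟩
  sumCount 0 m (λ i → sumCount 0 m (λ j → (w C j) * ([ j ⩽ i ] * ((b C (i ∸ j)) * φ i ((w ∸ j) + (i ∸ j))))))
    ≡⟨ sumCount-cong 0 m (λ i _ _ → sumCount-cong 0 m (λ j _ _ → same i j)) ⟩
  sumCount 0 m (λ i → sumCount 0 m (λ j → [ 1 ⩽ i ⩽ r ] * ([ ⌈ (w + i) ∸ r /2⌉ ⩽ j ⩽ w ⊓ i ] * ((w C j) * (b C (i ∸ j))))))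
    ≡⟨ sumCount-cong 0 m (λ i _ _ → ≡.trans (sumCount-* [ 1 ⩽ i ⩽ r ] 0 m _)
         (cong ([ 1 ⩽ i ⩽ r ] *_) (sumFromTo-indicator ⌈ (w + i) ∸ r /2⌉ (w ⊓ i) _ (≤-<-trans (m⊓n≤m w i) w<m)))) ⟩
  sumCount 0 m (λ i → [ 1 ⩽ i ⩽ r ] * sumFromTo ⌈ (w + i) ∸ r /2⌉ (w ⊓ i) (λ j → (w C j) * (b C (i ∸ j))))
    ≡⟨ sumFromTo-indicator 1 r _ (s≤s (m≤n+m r n)) ⟩
  innerSum n r w ∎
  where
  open ≡.≡-Reasoning
  b = n ∸ w
  -- One cutoff above every index that matters, so that all sums run over one square and can be
  -- exchanged.
  m = suc (n + r)
  φ : ℕ → ℕ → ℕ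
  φ i k = [ 1 ⩽ i ⩽ r ] * [ k ⩽ r ]
  w<m : w < m
  w<m = s≤s (≤-trans w≤n (m≤m+n n r))
  reindex : ∀ j → j ≤ w → bin b (λ l → φ (j + l) ((w ∸ j) + l)) ≡
    sumCount 0 m (λ i → [ j ⩽ i ] * ((b C (i ∸ j)) * φ i ((w ∸ j) + (i ∸ j))))
  reindex j j≤w = begin
    bin b (λ l → φ (j + l) ((w ∸ j) + l)) ≡⟨ bin-C b _ b<k ⟩
    sumCount 0 k (λ l → (b C l) * φ (j + l) ((w ∸ j) + l)) ≡⟨ sumCount-cong 0 k (λ l _ _ → shifted l) ⟩
    sumCount 0 k (λ l → G (j + l)) ≡⟨ sym (sumCount-offset j k G) ⟩
    sumCount j k G ≡⟨ cong (_+ sumCount j k G) (sym (sumCount-0 0 j before)) ⟩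
    sumCount 0 j G + sumCount j k G ≡⟨ sym (sumCount-split 0 j k G) ⟩
    sumCount 0 (j + k) G ≡⟨ cong (λ z → sumCount 0 z G) (m+[n∸m]≡n j≤m) ⟩
    sumCount 0 m G ∎
    where
    k = m ∸ j
    G : ℕ → ℕ
    G i = [ j ⩽ i ] * ((b C (i ∸ j)) * φ i ((w ∸ j) + (i ∸ j)))
    j≤m : j ≤ m
    j≤m = ≤-trans j≤w (<⇒≤ w<m)
    b<k : b < k
    b<k = m+n≤o⇒m≤o∸n (suc b) (s≤s (≤-trans (+-monoʳ-≤ b j≤w) (≤-trans (≤-reflexive (m∸n+n≡m w≤n)) (m≤m+n n r))))
    before : ∀ i → 0 ≤ i → i < j → G i ≡ 0
    before i _ i<j rewrite [⩽]-false (<⇒≱ i<j) = refl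
    shifted : ∀ l → (b C l) * φ (j + l) ((w ∸ j) + l) ≡ G (j + l)
    shifted l rewrite [⩽]-true (m≤m+n j l) | m+n∸m≡n j l = sym (*-identityˡ _)
  same : ∀ i j → (w C j) * ([ j ⩽ i ] * ((b C (i ∸ j)) * φ i ((w ∸ j) + (i ∸ j)))) ≡
    [ 1 ⩽ i ⩽ r ] * ([ ⌈ (w + i) ∸ r /2⌉ ⩽ j ⩽ w ⊓ i ] * ((w C j) * (b C (i ∸ j))))
  -- Both sides vanish unless j ≤ w and j ≤ i; there `half-bound` converts the remaining bracket.
  same i j with j ≤? w
  ... | no j≰w rewrite k>n⇒nCk≡0 (≰⇒> j≰w) | *-zeroʳ [ ⌈ (w + i) ∸ r /2⌉ ⩽ j ⩽ w ⊓ i ] = sym (*-zeroʳ [ 1 ⩽ i ⩽ r ])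
  ... | yes j≤w with j ≤? i
  ...   | no j≰i rewrite [⩽]-false j≰i | [⩽]-false {j} {w ⊓ i} (λ p → j≰i (≤-trans p (m⊓n≤n w i)))
                | *-zeroʳ [ ⌈ (w + i) ∸ r /2⌉ ⩽ j ] | *-zeroʳ [ 1 ⩽ i ⩽ r ] = *-zeroʳ (w C j)
  ...   | yes j≤i rewrite [⩽]-true j≤i | [⩽]-true (⊓-glb j≤w j≤i) | half-bound w i j r j≤w j≤i =
          rearrange (w C j) (b C (i ∸ j)) [ 1 ⩽ i ⩽ r ] [ ⌈ (w + i) ∸ r /2⌉ ⩽ j ]
    where
    rearrange : ∀ c c' x y → c * (1 * (c' * (x * y))) ≡ x * (y * 1 * (c * c'))
    rearrange = solve-∀

-- `sixE` as a count of adjacent pairs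

term : ℕ → ℕ → ℕ → ℤ
term n r w = (ℤ.+ (n C w)) ℤ.* (ℤ.+ (innerSum n r w) ℤ.- ℤ.+ 1)

terms : ℕ → ℕ → ℕ → ℕ → ℤ
terms n r w zero    = ℤ.+ 0
terms n r w (suc m) = term n r w ℤ.+ terms n r (suc w) m

-- The local function inside sixE has no name here: rest and sixE-from are given by unification, and abstracting
-- suc r and 2 to variables turns the equation for it into a pattern.
rest : ℕ → ℕ → ℤ
sixE-suc : ∀ n r → sixE n (suc r) ≡ term n (suc r) 1 ℤ.+ rest n r
rest n r = _
sixE-suc n r = refl

sixE-from : ∀ n r w m → _ ≡ terms n r w m
rest-terms : ∀ n r → rest n r ≡ terms n (suc r) 2 r
rest-terms n r with suc r | 2
... | k | w = sixE-from n k w r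
sixE-from n r w zero = refl
sixE-from n r w (suc m) = cong (ℤ._+_ (term n r w)) (sixE-from n r (suc w) m)

sixE-terms : ∀ n r → sixE n r ≡ terms n r 1 r
sixE-terms n zero = refl
sixE-terms n (suc r) = ≡.trans (sixE-suc n r) (cong (ℤ._+_ (term n (suc r) 1)) (rest-terms n r))

-- Adding back the 1 subtracted in each term leaves a sum of natural numbers; these ones stand for
-- the diagonal pairs in `∑-inner`.
sixE-sum : ∀ n r → sixE n r ℤ.+ ℤ.+ sumFromTo 1 r (n C_) ≡ ℤ.+ sumFromTo 1 r (λ w → (n C w) * innerSum n r w)
sixE-sum n r = ≡.trans (cong (ℤ._+ ℤ.+ sumFromTo 1 r (n C_)) (sixE-terms n r)) (go 1 r)
  where
  step : ∀ c x t s → c ℤ.* (x ℤ.- ℤ.+ 1) ℤ.+ t ℤ.+ (c ℤ.+ s) ≡ c ℤ.* x ℤ.+ (t ℤ.+ s)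
  step = ℤ-Solver.solve-∀
  go : ∀ w m → terms n r w m ℤ.+ ℤ.+ sumCount w m (n C_) ≡ ℤ.+ sumCount w m (λ w → (n C w) * innerSum n r w)
  go w zero = refl
  go w (suc m) =
    ≡.trans (step (ℤ.+ (n C w)) (ℤ.+ innerSum n r w) (terms n r (suc w) m) (ℤ.+ sumCount (suc w) m (n C_)))
      (cong₂ ℤ._+_ (sym (ℤ.pos-* (n C w) (innerSum n r w))) (go (suc w) m))

-- Group the pairs by the distance of `x` from `v`; the number of partners `y` depends only on that
-- distance.
∑-inner : ∀ {n} (v : Vec Bool n) r →
  ∑ (cube n) (λ x → [ 1 ⩽ hamming v x ⩽ r ] * ∑ (cube n) (λ y → [ 1 ⩽ hamming v y ⩽ r ] * [ hamming x y ⩽ r ]))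
  ≡ sumFromTo 1 r (λ w → (n C w) * innerSum n r w)
∑-inner {n} v r = begin
  ∑ (cube n) (λ x → [ 1 ⩽ hamming v x ⩽ r ] * ∑ (cube n) (λ y → [ 1 ⩽ hamming v y ⩽ r ] * [ hamming x y ⩽ r ]))
    ≡⟨ ∑-cong (cube n) (λ x → cong ([ 1 ⩽ hamming v x ⩽ r ] *_)
         (≡.trans (∑-hamming₂ v x (λ i k → [ 1 ⩽ i ⩽ r ] * [ k ⩽ r ])) (pairs-inner n r (hamming v x) (hamming≤n v x)))) ⟩
  ∑ (cube n) (λ x → [ 1 ⩽ hamming v x ⩽ r ] * innerSum n r (hamming v x))
    ≡⟨ ∑-hamming v (λ w → [ 1 ⩽ w ⩽ r ] * innerSum n r w) ⟩
  bin n (λ w → [ 1 ⩽ w ⩽ r ] * innerSum n r w) ≡⟨ bin-range n 1 r (innerSum n r) ⟩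
  sumFromTo 1 r (λ w → (n C w) * innerSum n r w) ∎
  where open ≡.≡-Reasoning

∑-sphere : ∀ {n} (v : Vec Bool n) r → ∑ (cube n) (λ x → [ 1 ⩽ hamming v x ⩽ r ]) ≡ sumFromTo 1 r (n C_)
∑-sphere {n} v r = begin
  ∑ (cube n) (λ x → [ 1 ⩽ hamming v x ⩽ r ]) ≡⟨ ∑-hamming v (λ w → [ 1 ⩽ w ⩽ r ]) ⟩
  bin n (λ w → [ 1 ⩽ w ⩽ r ]) ≡⟨ bin-cong n (λ w _ → sym (*-identityʳ _)) ⟩
  bin n (λ w → [ 1 ⩽ w ⩽ r ] * 1) ≡⟨ bin-range n 1 r (λ _ → 1) ⟩
  sumFromTo 1 r (λ w → (n C w) * 1) ≡⟨ sumCount-cong 1 r (λ w _ _ → *-identityʳ (n C w)) ⟩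
  sumFromTo 1 r (n C_) ∎
  where open ≡.≡-Reasoning

-- Filtered lists

∑-filterᵇ : {A : Set} (p : A → Bool) (xs : List A) (f : A → ℕ) →
  ∑ (filterᵇ p xs) f ≡ ∑ xs (λ x → ⟦ p x ⟧ * f x)
∑-filterᵇ p [] f = refl
∑-filterᵇ p (x ∷ xs) f with p x
... | true = cong₂ _+_ (sym (+-identityʳ (f x))) (∑-filterᵇ p xs f)
... | false = ∑-filterᵇ p xs f

All-filterᵇ : {A : Set} {P : A → Set} (p : A → Bool) → (∀ x → p x ≡ true → P x) → ∀ xs → All P (filterᵇ p xs)
All-filterᵇ p h [] = []
All-filterᵇ p h (x ∷ xs) with p x in eq
... | true = h x eq ∷ All-filterᵇ p h xs
... | false = All-filterᵇ p h xs

All-filterᵇ⁺ : {A : Set} {P : A → Set} (p : A → Bool) → ∀ {xs} → All P xs → All P (filterᵇ p xs)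
All-filterᵇ⁺ p [] = []
All-filterᵇ⁺ p {x ∷ xs} (h ∷ hs) with p x
... | true = h ∷ All-filterᵇ⁺ p hs
... | false = All-filterᵇ⁺ p hs

filterᵇ-split : {A : Set} (p : A → Bool) (xs : List A) → xs ↭ filterᵇ (not ∘ p) xs ++ filterᵇ p xs
filterᵇ-split p [] = refl
filterᵇ-split p (x ∷ xs) with p x
... | true = trans (prep x (filterᵇ-split p xs)) (↭-sym (shift x (filterᵇ (not ∘ p) xs) (filterᵇ p xs)))
... | false = prep x (filterᵇ-split p xs)

length≡∑ : {A : Set} (xs : List A) → length xs ≡ ∑ xs (λ _ → 1)
length≡∑ xs = sym (≡.trans (∑-const xs 1) (*-identityʳ (length xs)))

not-≤ᵇ-true : ∀ {a b} → not (a ≤ᵇ b) ≡ true → b < a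
not-≤ᵇ-true {a} {b} e with a ≤? b
... | no p = ≰⇒> p
... | yes p with a ≤ᵇ b | ≤⇒≤ᵇ p
not-≤ᵇ-true () | yes p | true | _

-- The hard-core model on the cube

module Cube (n r : ℕ) where

  near : Vec Bool n → Vec Bool n → Bool
  near x y = hamming x y ≤ᵇ r

  near-sym : ∀ x y → near x y ≡ near y x
  near-sym x y = cong (_≤ᵇ r) (hamming-sym x y)

  ball : Vec Bool n → List (Vec Bool n)
  ball v = filterᵇ (near v) (cube n)

  -- `sphere v` is the punctured ball, with all distances from 1 to `r`: the graph neighbourhood of
  -- `v`.
  centre sphere far : Vec Bool n → List (Vec Bool n)
  centre v = filterᵇ (λ u → not (1 ≤ᵇ hamming v u)) (ball v)
  sphere v = filterᵇ (λ u → 1 ≤ᵇ hamming v u) (ball v)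
  far v = filterᵇ (λ u → not (near v u)) (cube n)

  ∑-sphere-list : ∀ v f → ∑ (sphere v) f ≡ ∑ (cube n) (λ u → [ 1 ⩽ hamming v u ⩽ r ] * f u)
  ∑-sphere-list v f = ≡.trans (∑-filterᵇ _ (ball v) f) (≡.trans (∑-filterᵇ (near v) (cube n) _)
    (∑-cong (cube n) λ u → exchange [ hamming v u ⩽ r ] [ 1 ⩽ hamming v u ] (f u)))
    where
    exchange : ∀ a b c → a * (b * c) ≡ b * a * c
    exchange = solve-∀

  singleton : {A : Set} (v : A) (xs : List A) → All (_≡ v) xs → length xs ≡ 1 → xs ≡ v ∷ []
  singleton v (x ∷ []) (refl ∷ []) _ = refl

  -- All members equal `v`, and their number is V n 0 = 1.
  centre≡ : ∀ v → centre v ≡ v ∷ []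
  centre≡ v = singleton v (centre v)
    (All-filterᵇ _ (λ u e → sym (hamming-0 v u (n<1⇒n≡0 (not-≤ᵇ-true {1} {hamming v u} e)))) (ball v)) (begin
    length (centre v) ≡⟨ length≡∑ (centre v) ⟩
    ∑ (centre v) (λ _ → 1) ≡⟨ ∑-filterᵇ _ (ball v) _ ⟩
    ∑ (ball v) (λ u → ⟦ not (1 ≤ᵇ hamming v u) ⟧ * 1) ≡⟨ ∑-filterᵇ (near v) (cube n) _ ⟩
    ∑ (cube n) (λ u → [ hamming v u ⩽ r ] * (⟦ not (1 ≤ᵇ hamming v u) ⟧ * 1)) ≡⟨ ∑-cong (cube n) (λ u → zero-only (hamming v u)) ⟩
    ∑ (cube n) (λ u → [ hamming v u ⩽ 0 ]) ≡⟨ ∑-ball v 0 ⟩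
    1 ∎)
    where
    open ≡.≡-Reasoning
    zero-only : ∀ h → [ h ⩽ r ] * (⟦ not (1 ≤ᵇ h) ⟧ * 1) ≡ [ h ⩽ 0 ]
    zero-only zero = refl
    zero-only (suc h) = *-zeroʳ [ suc h ⩽ r ]

  -- The order of exposure that realises the conditioning: words not adjacent to `v`, then `v`, then
  -- its neighbours.
  order : ∀ v → cube n ↭ far v ++ v ∷ sphere v
  order v = trans (filterᵇ-split (near v) (cube n)) (++⁺ˡ (far v)
    (subst (λ c → ball v ↭ c ++ sphere v) (centre≡ v) (filterᵇ-split (λ u → 1 ≤ᵇ hamming v u) (ball v))))

  module Model (q : ℕ) .{{_ : NonZero q}} where
    open HardCore near near-sym q public

    edges₂-length : ∀ xs → edges₂ xs + length xs ≡ ∑ xs (λ x → ∑ xs (λ y → ⟦ near x y ⟧))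
    edges₂-length [] = refl
    edges₂-length (x ∷ xs) = begin
      2 * degree x xs + edges₂ xs + suc (length xs) ≡⟨ rearrange (degree x xs) (edges₂ xs) (length xs) ⟩
      1 + degree x xs + (degree x xs + (edges₂ xs + length xs))
        ≡⟨ cong₂ _+_ (cong₂ _+_ (sym self) flip) (cong (degree x xs +_) (edges₂-length xs)) ⟩
      ⟦ near x x ⟧ + ∑ xs (λ y → ⟦ near x y ⟧) + (degree x xs + ∑ xs (λ z → ∑ xs (λ y → ⟦ near z y ⟧)))
        ≡⟨ cong (⟦ near x x ⟧ + ∑ xs (λ y → ⟦ near x y ⟧) +_) (sym (∑-+ xs _ _)) ⟩
      ∑ (x ∷ xs) (λ z → ∑ (x ∷ xs) (λ y → ⟦ near z y ⟧)) ∎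
      where
      open ≡.≡-Reasoning
      rearrange : ∀ d e l → 2 * d + e + suc l ≡ 1 + d + (d + (e + l))
      rearrange = solve-∀
      self : ⟦ near x x ⟧ ≡ 1
      self = cong (λ h → [ h ⩽ r ]) (hamming-refl x)
      flip : degree x xs ≡ ∑ xs (λ y → ⟦ near x y ⟧)
      flip = ∑-cong xs λ y → cong ⟦_⟧ (near-sym y x)

    -- Adding the size of the sphere to both sides supplies the diagonal pairs and turns each into
    -- the same count of ordered pairs.
    edges₂-sphere : ∀ v → ℤ.+ edges₂ (sphere v) ≡ sixE n r
    edges₂-sphere v = ∙-cancelʳ (ℤ.+ sumFromTo 1 r (n C_)) _ _ (begin
      ℤ.+ (edges₂ (sphere v) + sumFromTo 1 r (n C_)) ≡⟨ cong (λ z → ℤ.+ (edges₂ (sphere v) + z)) (sym count) ⟩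
      ℤ.+ (edges₂ (sphere v) + length (sphere v)) ≡⟨ cong ℤ.+_ (edges₂-length (sphere v)) ⟩
      ℤ.+ ∑ (sphere v) (λ x → ∑ (sphere v) (λ y → ⟦ near x y ⟧)) ≡⟨ cong ℤ.+_ total ⟩
      ℤ.+ sumFromTo 1 r (λ w → (n C w) * innerSum n r w) ≡⟨ sym (sixE-sum n r) ⟩
      sixE n r ℤ.+ ℤ.+ sumFromTo 1 r (n C_) ∎)
      where
      open ≡.≡-Reasoning
      count : length (sphere v) ≡ sumFromTo 1 r (n C_)
      count = ≡.trans (length≡∑ (sphere v)) (≡.trans (∑-sphere-list v (λ _ → 1))
        (≡.trans (∑-cong (cube n) λ u → *-identityʳ _) (∑-sphere v r)))
      total : ∑ (sphere v) (λ x → ∑ (sphere v) (λ y → ⟦ near x y ⟧)) ≡ sumFromTo 1 r (λ w → (n C w) * innerSum n r w)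
      total = ≡.trans (∑-sphere-list v _)
        (≡.trans (∑-cong (cube n) λ x → cong ([ 1 ⩽ hamming v x ⩽ r ] *_) (∑-sphere-list v _)) (∑-inner v r))

    w : ℕ
    w = V n r

    -- Summed over u in I this is w · [v ∈ I] plus the number of members of I in the ball of `v`.
    weight : Vec Bool n → Vec Bool n → ℕ
    weight v u = w * [ hamming v u ⩽ 0 ] + [ hamming v u ⩽ r ]

    -- Choices among the words far from `v` never block `v`, so `neighbourhood-bound` applies in
    -- every resulting state and `E-mono` sums it up.
    vertex-bound : ∀ h j s → Q ≡ 2 * h → sixE n r ≡ ℤ.+ s → 2 * s ≤ Q * Q → j * Q * 2 ^ j ≤ w → ∀ v →
      j * ζ (cube n) [] ≤ 2 * E (cube n) [] (λ I → ∑ I (weight v))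
    vertex-bound h j s Q≡ s≡ s≤ w≥ v =
      subst₂ (λ a b → j * a ≤ 2 * b)
        (sym (≡.trans (E-↭ const-symmetric (order v) []) (E-++ (far v) (v ∷ sphere v) [] _)))
        (sym (≡.trans (E-↭ (∑-↭ (weight v)) (order v) []) (E-++ (far v) (v ∷ sphere v) [] _)))
        (E-mono (λ J → free v J ≡ true) j 2
          (λ J → neighbourhood-bound near near-sym q (weight v) h j w v (sphere v) J Q≡
            (≤-trans (≤-reflexive (cong (2 *_) (ℤ.+-injective (≡.trans (edges₂-sphere v) s≡)))) s≤)
            w≥ centre-weight
            (All.map (λ {u} → sphere-weight {u}) sphere-near)
            (All.map (λ {u} e → ≡.trans (near-sym u v) e) sphere-near))
          (far v) (All-filterᵇ _ step (cube n)) [] refl)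
      where
      sphere-near : All (λ u → near v u ≡ true) (sphere v)
      sphere-near = All-filterᵇ⁺ _ (All-filterᵇ (near v) (λ _ e → e) (cube n))
      sphere-weight : ∀ {u} → near v u ≡ true → 1 ≤ weight v u
      sphere-weight {u} e rewrite e = m≤n+m 1 (w * [ hamming v u ⩽ 0 ])
      centre-weight : w ≤ weight v v
      centre-weight = subst (λ k → w ≤ w * [ k ⩽ 0 ] + [ k ⩽ r ]) (sym (hamming-refl v))
        (≤-trans (≤-reflexive (sym (*-identityʳ w))) (m≤m+n (w * 1) 1))
      step : ∀ x → not (near v x) ≡ true → ∀ J → free v J ≡ true → free x J ≡ true → free v (x ∷ J) ≡ true
      step x e J f _ rewrite e = f

    -- Each u in `I` collects `w` from the term with v = u and V n r = w from the balls that contain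
    -- it.
    ∑-weight : ∀ I → ∑ (cube n) (λ v → ∑ I (weight v)) ≡ length I * (2 * w)
    ∑-weight I = ≡.trans (∑-swap (cube n) I weight) (≡.trans (∑-cong I per) (∑-const I (2 * w)))
      where
      count : ∀ u k → ∑ (cube n) (λ v → [ hamming v u ⩽ k ]) ≡ V n k
      count u k = ≡.trans (∑-cong (cube n) λ v → cong (λ h → [ h ⩽ k ]) (hamming-sym v u)) (∑-ball u k)
      per : ∀ u → ∑ (cube n) (λ v → weight v u) ≡ 2 * w
      per u = ≡.trans (∑-+ (cube n) _ _)
        (cong₂ _+_ (≡.trans (∑-* w (cube n) _) (≡.trans (cong (w *_) (count u 0)) (*-identityʳ w)))
          (≡.trans (count u r) (sym (+-identityʳ w))))

    free-code : ∀ x J → free x J ≡ true → All (λ y → suc r ≤ hamming x y) J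
    free-code x [] _ = []
    free-code x (y ∷ J) e with near x y in eq
    ... | false = not-≤ᵇ-true {hamming x y} (cong not eq) ∷ free-code x J e

    size-bound : ∀ a → (∀ K → IsCode n (suc r) K → length K ≤ a) →
      E (cube n) [] (λ I → length I * (2 * w)) ≤ a * (2 * w) * ζ (cube n) []
    size-bound a le = ≤-trans (≤-reflexive (sym (*-identityˡ _)))
      (E-mono (IsCode n (suc r)) 1 (a * (2 * w))
        (λ J c → ≤-trans (≤-reflexive (*-identityˡ _))
          (≤-trans (*-monoˡ-≤ (2 * w) (le J c)) (≤-reflexive (sym (*-identityʳ _)))))
        (cube n) (All.universal (λ x J c e → free-code x J e ∷ c) (cube n)) [] [])

    -- Sum the vertex bound over all centres, exchange the sums, and bound every independent set by
    -- `a`. The common factor ζ is positive because the empty set has positive weight.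
    global-bound : ∀ h j s a → Q ≡ 2 * h → sixE n r ≡ ℤ.+ s → 2 * s ≤ Q * Q → j * Q * 2 ^ j ≤ w →
      (∀ K → IsCode n (suc r) K → length K ≤ a) → 2 ^ n * j ≤ 4 * a * w
    global-bound h j s a Q≡ s≡ s≤ w≥ le =
      *-cancelʳ-≤ _ _ (ζ (cube n) []) {{>-nonZero (<-≤-trans (m^n>0 q (length (cube n))) (ζ≥ (cube n) []))}} (begin
      2 ^ n * j * z ≡⟨ *-assoc (2 ^ n) j z ⟩
      2 ^ n * (j * z) ≡⟨ cong (_* (j * z)) (≡.trans (sym (∑-cube-1 n)) (sym (length≡∑ (cube n)))) ⟩
      length (cube n) * (j * z) ≡⟨ sym (∑-const (cube n) (j * z)) ⟩
      ∑ (cube n) (λ _ → j * z) ≤⟨ ∑-mono (cube n) (vertex-bound h j s Q≡ s≡ s≤ w≥) ⟩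
      ∑ (cube n) (λ v → 2 * E (cube n) [] (λ I → ∑ I (weight v))) ≡⟨ ∑-* 2 (cube n) _ ⟩
      2 * ∑ (cube n) (λ v → E (cube n) [] (λ I → ∑ I (weight v)))
        ≡⟨ cong (2 *_) (sym (E-∑ (cube n) (λ v I → ∑ I (weight v)) (cube n) [])) ⟩
      2 * E (cube n) [] (λ I → ∑ (cube n) (λ v → ∑ I (weight v)))
        -- A trivial invariant and factors 1 let `E-mono` carry the pointwise identity through `E`.
        ≤⟨ *-monoʳ-≤ 2 (subst₂ _≤_ (*-identityˡ _) (*-identityˡ _) (E-mono (λ _ → ⊤) 1 1
             (λ J _ → ≤-reflexive (cong (1 *_) (∑-weight J))) (cube n)
             (All.universal (λ _ _ _ _ → tt) (cube n)) [] tt)) ⟩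
      2 * E (cube n) [] (λ I → length I * (2 * w)) ≤⟨ *-monoʳ-≤ 2 (size-bound a le) ⟩
      2 * (a * (2 * w) * z) ≡⟨ rearrange a w z ⟩
      4 * a * w * z ∎)
      where
      open ≤-Reasoning
      z = ζ (cube n) []
      rearrange : ∀ a w z → 2 * (a * (2 * w) * z) ≡ 4 * a * w * z
      rearrange = solve-∀

  covered : ∀ u (K : List (Vec Bool n)) → 1 ≤ ∑ K (λ c → [ hamming c u ⩽ r ]) ⊎ All (λ c → suc r ≤ hamming u c) K
  covered u [] = inj₂ []
  covered u (c ∷ K) with hamming c u ≤? r
  ... | yes p rewrite [⩽]-true p = inj₁ (s≤s z≤n)
  ... | no p with covered u K
  ...   | inj₁ q = inj₁ (≤-trans q (m≤n+m _ [ hamming c u ⩽ r ]))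
  ...   | inj₂ q = inj₂ (subst (suc r ≤_) (hamming-sym c u) (≰⇒> p) ∷ q)

  -- Gilbert's argument: a word outside all balls of radius `r` around an optimal code could be
  -- added to it.
  covering-bound : ∀ a → IsA₂ n (suc r) a → 2 ^ n ≤ a * V n r
  covering-bound a ((K , code , refl) , le) = begin
    2 ^ n ≡⟨ sym (∑-cube-1 n) ⟩
    ∑ (cube n) (λ _ → 1) ≤⟨ ∑-mono (cube n) cover ⟩
    ∑ (cube n) (λ u → ∑ K (λ c → [ hamming c u ⩽ r ])) ≡⟨ ∑-swap (cube n) K _ ⟩
    ∑ K (λ c → ∑ (cube n) (λ u → [ hamming c u ⩽ r ])) ≡⟨ ∑-cong K (λ c → ∑-ball c r) ⟩
    ∑ K (λ _ → V n r) ≡⟨ ∑-const K (V n r) ⟩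
    length K * V n r ∎
    where
    open ≤-Reasoning
    cover : ∀ u → 1 ≤ ∑ K (λ c → [ hamming c u ⩽ r ])
    cover u with covered u K
    ... | inj₁ p = p
    ... | inj₂ p = ⊥-elim (1+n≰n (le (u ∷ K) (p ∷ code)))

-- Choice of parameters

-- The search walks down from `k` while the bound persists, so failure is recorded at the immediate
-- predecessor of `j`; for monotone `f` this is the least index.
least : ∀ (f : ℕ → ℕ) b k → b ≤ f k → ∃ λ j → b ≤ f j × (∀ i → j ≡ suc i → f i < b)
least f b zero le = 0 , le , λ i ()
least f b (suc k) le with b ≤? f k
... | yes p = least f b k p
... | no p = suc k , le , λ { _ refl → ≰⇒> p }

n≤32^n : ∀ n → n ≤ 32 ^ n
n≤32^n zero = z≤n
n≤32^n (suc n) = ≤-trans (+-mono-≤ (m^n>0 32 n) (n≤32^n n)) (+-monoʳ-≤ (32 ^ n) (m≤m+n (32 ^ n) (30 * 32 ^ n)))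

n≤[2n]² : ∀ n → n ≤ 2 * n * (2 * n)
n≤[2n]² zero = z≤n
n≤[2n]² n@(suc _) = ≤-trans (m≤m+n n _) (m≤m*n (2 * n) (2 * n))

-- Here Q = 2 * suc h; the constant 16 / 3 is small enough for volume-large to hold already at its first exponent 5.
even-root : ∀ s → 1 ≤ s → ∃ λ h → 2 * s ≤ 2 * suc h * (2 * suc h) × 3 * (2 * suc h * (2 * suc h)) ≤ 16 * s
even-root s s≥1 with least (λ h → 2 * h * (2 * h)) (2 * s) (2 * s) (n≤[2n]² (2 * s))
... | zero , le , _ = ⊥-elim (<⇒≱ s≥1 (*-cancelˡ-≤ 2 le))
-- At roots 1 and 2 the preceding square is too small for the general comparison; s ≥ 1 and s ≥ 3
-- serve instead.
... | suc zero , le , _ = 0 , le , ≤-trans (≤ᵇ⇒≤ 12 16 _) (*-monoʳ-≤ 16 s≥1)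
... | suc (suc zero) , le , min = 1 , le , *-monoʳ-≤ 16 (*-cancelˡ-< 2 2 s (min 1 refl))
... | suc (suc (suc k)) , le , min = suc (suc k) , le , (begin
  3 * (2 * suc (suc (suc k)) * (2 * suc (suc (suc k)))) ≤⟨ m≤m+n _ (20 * (k * k) + 56 * k + 20) ⟩
  3 * (2 * suc (suc (suc k)) * (2 * suc (suc (suc k)))) + (20 * (k * k) + 56 * k + 20) ≡⟨ rearrange k ⟩
  8 * (2 * suc (suc k) * (2 * suc (suc k))) ≤⟨ *-monoʳ-≤ 8 (<⇒≤ (min (suc (suc k)) refl)) ⟩
  8 * (2 * s) ≡⟨ sym (*-assoc 8 2 s) ⟩
  16 * s ∎)
  where
  open ≤-Reasoning
  rearrange : ∀ k → 3 * (2 * suc (suc (suc k)) * (2 * suc (suc (suc k)))) + (20 * (k * k) + 56 * k + 20) ≡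
    8 * (2 * suc (suc k) * (2 * suc (suc k)))
  rearrange = solve-∀

-- The bases stay variables because Agda would unfold a literal 32 ^ suc n during conversion checking.
exponential-bound : ∀ x y → x ≡ 32 → y ≡ 4 → ∀ t → (5 + t) * (5 + t) * y ^ (5 + t) ≤ x ^ (3 + t)
-- 25 · 4 ^ 5 ≤ 32 ^ 3. One exponent lower, 16 · 4 ^ 4 ≤ 32 ^ 2 fails, hence the separate treatment
-- of j ≤ 4.
exponential-bound x y refl refl zero = ≤ᵇ⇒≤ 25600 32768 _
exponential-bound x y x≡ y≡ (suc t) = begin
  suc (5 + t) * suc (5 + t) * (y * y ^ (5 + t)) ≤⟨ step x y x≡ y≡ (y ^ (5 + t)) ⟩
  x * ((5 + t) * (5 + t) * y ^ (5 + t)) ≤⟨ *-monoʳ-≤ x (exponential-bound x y x≡ y≡ t) ⟩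
  x * x ^ (3 + t) ∎
  where
  open ≤-Reasoning
  expand : ∀ t p → suc (5 + t) * suc (5 + t) * (4 * p) + (656 + 272 * t + 28 * (t * t)) * p ≡ 32 * ((5 + t) * (5 + t) * p)
  expand = solve-∀
  step : ∀ x y → x ≡ 32 → y ≡ 4 → ∀ p → suc (5 + t) * suc (5 + t) * (y * p) ≤ x * ((5 + t) * (5 + t) * p)
  step _ _ refl refl p = ≤-trans (m≤m+n _ ((656 + 272 * t + 28 * (t * t)) * p)) (≤-reflexive (expand t p))

-- Put j = 5 + t and compare squares: a smaller `w` would contradict s · 32 ^ (j - 1) < 6 w², using
-- 3 Q² ≤ 16 s and j² · 4 ^ j ≤ 32 ^ (j - 2). The constants meet because 16 · 6 = 3 · 32.
volume-large : ∀ x → x ≡ 32 → ∀ w s Q t → s * x ^ (4 + t) < 6 * w * w → 3 * (Q * Q) ≤ 16 * s →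
  (5 + t) * Q * 2 ^ (5 + t) ≤ w
volume-large x x≡ w s Q t lt Q≤ = ≮⇒≥ λ w< → <-irrefl refl (begin-strict
  3 * (Q * Q) * x ^ (4 + t) ≤⟨ *-monoˡ-≤ (x ^ (4 + t)) Q≤ ⟩
  16 * s * x ^ (4 + t) ≡⟨ *-assoc 16 s (x ^ (4 + t)) ⟩
  16 * (s * x ^ (4 + t)) <⟨ *-monoʳ-< 16 lt ⟩
  16 * (6 * w * w) ≤⟨ bound (5 + t) (2 ^ (5 + t)) (<⇒≤ w<) ⟩
  96 * (Q * Q) * ((5 + t) * (5 + t) * (2 ^ (5 + t) * 2 ^ (5 + t)))
    ≡⟨ cong (λ z → 96 * (Q * Q) * ((5 + t) * (5 + t) * z)) (sym (^-distribʳ-* (5 + t) 2 2)) ⟩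
  96 * (Q * Q) * ((5 + t) * (5 + t) * 4 ^ (5 + t)) ≤⟨ *-monoʳ-≤ (96 * (Q * Q)) (exponential-bound x 4 x≡ refl t) ⟩
  96 * (Q * Q) * x ^ (3 + t) ≡⟨ regroup x x≡ (Q * Q) (x ^ (3 + t)) ⟩
  3 * (Q * Q) * x ^ (4 + t) ∎)
  where
  open ≤-Reasoning
  square : ∀ w → 16 * (6 * w * w) ≡ 96 * (w * w)
  square = solve-∀
  collect : ∀ j Q p → 96 * (j * Q * p * (j * Q * p)) ≡ 96 * (Q * Q) * (j * j * (p * p))
  collect = solve-∀
  bound : ∀ j p → w ≤ j * Q * p → 16 * (6 * w * w) ≤ 96 * (Q * Q) * (j * j * (p * p))
  bound j p le = ≤-trans (≤-reflexive (square w)) (≤-trans (*-monoʳ-≤ 96 (*-mono-≤ le le)) (≤-reflexive (collect j Q p)))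
  split : ∀ a b → 96 * a * b ≡ 3 * a * (32 * b)
  split = solve-∀
  regroup : ∀ x → x ≡ 32 → ∀ a b → 96 * a * b ≡ 3 * a * (x * b)
  regroup _ refl = split

-- Up to j = 4 the covering bound suffices; from 5 on, minimality of j makes the ball large enough
-- for the hard-core bound.
exponent : ∀ n r a s x → x ≡ 32 → 1 ≤ s → sixE n r ≡ ℤ.+ s → IsA₂ n (suc r) a →
  ∃ λ j → 6 * V n r * V n r ≤ s * x ^ j × 2 ^ n * j ≤ 4 * a * V n r
exponent n r a s x x≡ s≥1 s≡ A@(_ , le) = j , proj₁ (proj₂ found) , bound j (proj₂ (proj₂ found))
  where
  open Cube n r
  w = V n r
  reach : ∀ x → x ≡ 32 → ∀ b → b ≤ s * x ^ b
  reach _ refl b = ≤-trans (n≤32^n b) (≤-trans (≤-reflexive (sym (*-identityˡ _))) (*-monoˡ-≤ (32 ^ b) s≥1))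
  -- The search may start at 6 w² itself, by `n≤32^n` and s ≥ 1.
  found = least (λ j → s * x ^ j) (6 * w * w) (6 * w * w) (reach x x≡ _)
  j = proj₁ found
  small : ∀ j → j ≤ 4 → 2 ^ n * j ≤ 4 * a * w
  small j j≤4 = ≤-trans (*-mono-≤ (covering-bound a A) j≤4)
    (≤-reflexive (≡.trans (*-comm (a * w) 4) (sym (*-assoc 4 a w))))
  bound : ∀ j → (∀ i → j ≡ suc i → s * x ^ i < 6 * w * w) → 2 ^ n * j ≤ 4 * a * w
  bound j min with j ≤? 4
  ... | yes j≤4 = small j j≤4
  ... | no j≰4 = large j (j ∸ 5) (sym (m+[n∸m]≡n (≰⇒> j≰4))) min (even-root s s≥1)
    where
    large : ∀ j t → j ≡ 5 + t → (∀ i → j ≡ suc i → s * x ^ i < 6 * w * w) →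
      (∃ λ h → 2 * s ≤ 2 * suc h * (2 * suc h) × 3 * (2 * suc h * (2 * suc h)) ≤ 16 * s) →
      2 ^ n * j ≤ 4 * a * w
    large _ t refl min (h , lower , upper) =
      Model.global-bound q {{>-nonZero (≤-trans (s≤s z≤n) (m≤n+m _ h))}} (suc h) (5 + t) s a refl s≡ lower
        (volume-large x x≡ w s (suc q) t (min (4 + t) refl) upper) le
      where
      -- This spelling of 2h + 1 makes `suc q ≡ 2 * suc h` hold by `refl`.
      q = h + suc (h + 0)

-- From the exponent to the power inequality

positive : ∀ z → ℤ.+ 0 ℤ.< z → ∃ λ s → z ≡ ℤ.+ s × 1 ≤ s
positive (ℤ.+ suc s) _ = suc s , refl , s≤s z≤n
positive (ℤ.+ zero) (ℤ.+<+ ())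

pos-^ : ∀ s k → (ℤ.+ s) ℤ.^ k ≡ ℤ.+ (s ^ k)
pos-^ s zero = refl
pos-^ s (suc k) = ≡.trans (cong (ℤ.+ s ℤ.*_) (pos-^ s k)) (sym (ℤ.pos-* s (s ^ k)))

exponentiate : ∀ b s j N c x → x ≡ 2 ^ 5 → b ≤ s * x ^ j → N * j ≤ c → b ^ N ≤ 2 ^ (5 * c) * s ^ N
exponentiate b s j N c x x≡ b≤ Nj≤ = begin
  b ^ N ≤⟨ ^-monoˡ-≤ N b≤ ⟩
  (s * x ^ j) ^ N ≡⟨ ^-distribʳ-* N s (x ^ j) ⟩
  s ^ N * (x ^ j) ^ N ≡⟨ cong (s ^ N *_) (^-*-assoc x j N) ⟩
  s ^ N * x ^ (j * N) ≡⟨ cong (λ y → s ^ N * y ^ (j * N)) x≡ ⟩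
  s ^ N * (2 ^ 5) ^ (j * N) ≡⟨ cong (s ^ N *_) (^-*-assoc 2 5 (j * N)) ⟩
  s ^ N * 2 ^ (5 * (j * N)) ≤⟨ *-monoʳ-≤ (s ^ N) (^-monoʳ-≤ 2 (*-monoʳ-≤ 5 (≤-trans (≤-reflexive (*-comm j N)) Nj≤))) ⟩
  s ^ N * 2 ^ (5 * c) ≡⟨ *-comm (s ^ N) (2 ^ (5 * c)) ⟩
  2 ^ (5 * c) * s ^ N ∎
  where open ≤-Reasoning

-- With `sixE` = 6e, base-2 logarithms give 2 ^ n (2 log V - log e) ≤ 20 a V, and division by 20 V
-- gives the bound in its real form. Positivity of `sixE` makes log e meaningful.
theorem1 : (n d : ℕ) → 1 ≤ d → d ≤ n → ℤ.+ 0 ℤ.< sixE n (d ∸ 1) →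
    (a : ℕ) → IsA₂ n d a →
    ℤ.+ ((6 * V n (d ∸ 1) * V n (d ∸ 1)) ^ (2 ^ n))
    ℤ.≤ ℤ.+ (2 ^ (20 * a * V n (d ∸ 1))) ℤ.* (sixE n (d ∸ 1) ℤ.^ (2 ^ n))
theorem1 n (suc r) _ _ sixE>0 a A with positive (sixE n r) sixE>0
... | s , s≡ , s≥1 with exponent n r a s 32 refl s≥1 s≡ A
... | j , w≤ , Nj≤ = subst (ℤ.+ ((6 * w * w) ^ (2 ^ n)) ℤ.≤_) (begin
  ℤ.+ (2 ^ (5 * (4 * a * w)) * s ^ (2 ^ n)) ≡⟨ ℤ.pos-* (2 ^ (5 * (4 * a * w))) (s ^ (2 ^ n)) ⟩
  ℤ.+ (2 ^ (5 * (4 * a * w))) ℤ.* ℤ.+ (s ^ (2 ^ n))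
    ≡⟨ cong₂ (λ e z → ℤ.+ (2 ^ e) ℤ.* z) (regroup a w) (sym (≡.trans (cong (ℤ._^ (2 ^ n)) s≡) (pos-^ s (2 ^ n)))) ⟩
  ℤ.+ (2 ^ (20 * a * w)) ℤ.* (sixE n r ℤ.^ (2 ^ n)) ∎)
  (ℤ.+≤+ (exponentiate (6 * w * w) s j (2 ^ n) (4 * a * w) 32 refl w≤ Nj≤))
  where
  open ≡.≡-Reasoning
  w = V n r
  regroup : ∀ a w → 5 * (4 * a * w) ≡ 20 * a * w
  regroup = solve-∀
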